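{- For every integer $n\ge 5$, the boxicity of the Kneser graph $Kn(2,n)$ is either $n-3$ or $n-2$.
   Context: An axis-parallel $d$-dimensional box is a cartesian product $I_1\times I_2\times\dots\times I_d$ where each $I_i$ is a closed sub-interval of the real line (the whole line $\mathbb R$ is allowed). For a finite graph $G=(V,E)$, the boxicity of $G$ is the minimum dimension $d\geq 0$ such that $G$ is the intersection graph of a family $(B_v)_{v\in V}$ of $d$-dimensional axis-parallel boxes in $\mathbb R^d$, i.e. distinct $u,v\in V$ are adjacent if and only if $B_u\cap B_v\ne\varnothing$. The Kneser graph $Kn(2,n)$ has as vertices all $2$-element subsets of $[n]=\{1,\dots,n\}$, two vertices being adjacent if the corresponding sets are disjoint. -}

module Defs where

open import Data.Fin.Subset using (Subset; Empty; ∣_∣; _∩_)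
open import Data.Fin.Subset.Properties using (Empty-unique; ∣⊥∣≡0; ∩-idem; ∩-comm)
open import Data.Nat.Base using (ℕ; NonZero; ≢-nonZero⁻¹)
import Data.Nat.Base as ℕ
open import Data.Product.Base using (∃; ∃-syntax; _×_; _,_; proj₁)
open import Data.Rational.Base using (ℚ; _<_)
open import Data.Sum.Base using (_⊎_)
open import Data.Vec.Functional using (Vector)
open import Function.Bundles using (_⇔_)
open import Level using (0ℓ)
open import Relation.Binary.Core using (Rel)
open import Relation.Binary.Definitions using (Symmetric; Irreflexive)
open import Relation.Binary.PropositionalEquality
  using (_≡_; _≢_; refl; sym; trans; cong; subst)
open import Relation.Nullary.Negation.Core using (¬_)
open import Relation.Unary using (Pred; _∈_; _⊆_; _≬_; U)

-- Real numbers as two-sided Dedekind cuts of ℚ.  Two cuts represent the same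
-- real number when each is ≤ the other; _≡_ on ℝ is never used.
record ℝ : Set₁ where
  field
    lower           : Pred ℚ 0ℓ
    upper           : Pred ℚ 0ℓ
    lower-inhabited : ∃[ q ] lower q
    upper-inhabited : ∃[ q ] upper q
    lower-rounded   : ∀ q → lower q ⇔ (∃[ r ] (q < r × lower r))
    upper-rounded   : ∀ q → upper q ⇔ (∃[ r ] (r < q × upper r))
    disjoint        : ∀ q → ¬ (lower q × upper q)
    located         : ∀ {q r} → q < r → lower q ⊎ upper r

infix 4 _≤_

_≤_ : Rel ℝ 0ℓ
x ≤ y = ℝ.lower x ⊆ ℝ.lower y

-- Nonempty closed intervals, bounded or not.
data ClosedInterval : Set₁ where
  [_,_]⟨_⟩ : (a b : ℝ) → a ≤ b → ClosedInterval
  [_,∞⟩    : ℝ → ClosedInterval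
  ⟨-∞,_]   : ℝ → ClosedInterval
  ⟨-∞,∞⟩   : ClosedInterval

⟦_⟧ : ClosedInterval → Pred ℝ 0ℓ
⟦ [ a , b ]⟨ _ ⟩ ⟧ x = a ≤ x × x ≤ b
⟦ [ a ,∞⟩ ⟧        x = a ≤ x
⟦ ⟨-∞, b ] ⟧       x = x ≤ b
⟦ ⟨-∞,∞⟩ ⟧           = U

Box : ℕ → Set₁
Box d = Vector ClosedInterval d

⟦_⟧ᴮ : ∀ {d} → Box d → Pred (Vector ℝ d) 0ℓ
⟦ B ⟧ᴮ x = ∀ i → x i ∈ ⟦ B i ⟧

record Graph : Set₁ where
  field
    Vertex      : Set
    _~_         : Rel Vertex 0ℓ
    ~-sym       : Symmetric _~_
    ~-irrefl    : Irreflexive _≡_ _~_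

-- _≬_ says that two sets have a common element.
IsIntersectionGraphOf : ∀ {d} (G : Graph) → (Graph.Vertex G → Box d) → Set₁
IsIntersectionGraphOf G B =
  ∀ {u v} → u ≢ v → (u ~ v) ⇔ (⟦ B u ⟧ᴮ ≬ ⟦ B v ⟧ᴮ)
  where open Graph G

HasBoxRepresentation : Graph → ℕ → Set₁
HasBoxRepresentation G d =
  ∃ λ (B : Graph.Vertex G → Box d) → IsIntersectionGraphOf G B

-- A relation rather than a function: the minimum is not computed.
IsBoxicity : Graph → ℕ → Set₁
IsBoxicity G d =
  HasBoxRepresentation G d × (∀ m → HasBoxRepresentation G m → d ℕ.≤ m)

-- The ground set {1, …, n} is represented by Fin n.
Kn : (k n : ℕ) → .{{NonZero k}} → Graph
Kn k n = record
  { Vertex   = ∃ λ (s : Subset n) → ∣ s ∣ ≡ k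
  ; _~_      = λ s t → Empty (proj₁ s ∩ proj₁ t)
  ; ~-sym    = λ { {s , _} {t , _} → subst Empty (∩-comm s t) }
  ; ~-irrefl = λ { {s , ∣s∣≡k} refl s∩s-empty →
      ≢-nonZero⁻¹ k
        (trans (sym ∣s∣≡k)
          (trans (cong ∣_∣ (trans (sym (∩-idem s)) (Empty-unique s∩s-empty)))
            (∣⊥∣≡0 n))) }
  }

{-# OPTIONS --safe #-}

-- The coordinates of a box representation of G are interval orders covering exactly the
-- nonadjacent pairs, so a representation of Kn(2,n) covers the cherries {xy, xz} by
-- interval orders in which comparable pairs intersect.  The stars at all vertices but two
-- give n − 2 such orders.
--
-- For the lower bound n − 3, an order whose cherries all contain a vertex a is removed
-- together with a.  If no order is of this kind, let ab be a pair with the earliest right end and ac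
-- one with the latest left end.  Then e ≺ f forces f to meet ab and e to meet ac, and
-- as the order also covers a cherry avoiding a, it covers at most 7n − 16 cherries.  But
-- (n − 4)(7n − 16) < n(n − 1)(n − 2)/2, the number of all cherries, if n ≥ 5.
--
-- Constructively one has to decide whether n − 3 coordinates suffice: this is a finite
-- search over relations, because box representations and covers by interval orders imply
-- each other up to double negation.
module Submission where

open import Defs renaming (_≤_ to _≤ʳ_)
open import Data.Bool.Base using (Bool; true; false; T)
open import Data.Bool.Properties as Bool using (T?)
open import Data.Fin.Base using (Fin; zero; suc; toℕ; inject₁; punchIn; punchOut; fromℕ; remQuot; combine)
open import Data.Fin.Patterns
open import Data.Fin.Properties as Fin using (_≟_; any?; all?; sequence; punchInᵢ≢i; punchIn-injective; punchIn-punchOut; toℕ-injective; toℕ-fromℕ; toℕ≤pred[n]; injective⇒≤; combine-remQuot)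
open import Data.Fin.Relation.Unary.Top using (view; ‵fromℕ; ‵inject₁)
open import Data.Fin.Subset using (Subset; inside; outside; ⁅_⁆; ∣_∣; _∪_; _∩_) renaming (_∈_ to _∈ˢ_; ⊥ to ∅)
open import Data.Fin.Subset.Properties using (_∈?_; nonempty?; ∪-identityˡ; ∪-identityʳ; ∪-comm; ∣⁅x⁆∣≡1; x∈⁅x⁆; x∈⁅y⁆⇒x≡y; x∈p∪q⁺; x∈p∪q⁻; x∈p∩q⁺; x∈p∩q⁻)
import Data.Integer.Base as ℤ
import Data.Integer.Properties as ℤ
open import Data.List.Base as List using (List; []; _∷_; _++_; length; filter; lookup; concat; concatMap; allFin; cartesianProduct)
open import Data.List.Extrema.Nat using (max; max<v⁺; xs≤max)
open import Data.List.Membership.Propositional using (lose) renaming (_∈_ to _∈ˡ_)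
open import Data.List.Membership.Propositional.Properties using (∈-map⁺; ∈-filter⁺; ∈-allFin; ∈-++⁺ˡ; ∈-++⁺ʳ; ∈-concat⁺′; ∈-lookup; ∈-cartesianProduct⁺)
open import Data.List.Properties using (length-map; length-++; length-tabulate; filter-notAll)
open import Data.List.Relation.Unary.All as All using (All; []; _∷_)
import Data.List.Relation.Unary.All.Properties as All
open import Data.List.Relation.Unary.AllPairs using ([]; _∷_)
open import Data.List.Relation.Unary.Any using (here; there; index)
open import Data.List.Relation.Unary.Any.Properties using (lookup-index)
open import Data.List.Relation.Unary.Unique.Propositional using (Unique)
open import Data.Maybe.Base using (Maybe; just; nothing)
open import Data.Nat.Base using (ℕ; zero; suc; _≤_; _<_; _≥_; _+_; _*_; _∸_; _⊔_; z≤n; s≤s)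
open import Data.Nat.Properties hiding (_≟_)
open import Data.Nat.Tactic.RingSolver using (solve-∀)
open import Data.Product.Base as Product using (∃; ∃₂; _×_; _,_; proj₁; proj₂)
open import Data.Rational.Base using (*<*) renaming (_<_ to _<ℚ_)
open import Data.Rational.Literals using (fromℤ)
import Data.Rational.Properties as ℚ
open import Data.Sum.Base as Sum using (_⊎_; inj₁; inj₂; [_,_])
open import Data.Unit.Base using (tt)
open import Data.Vec.Base using (Vec; []; _∷_; tabulate) renaming (lookup to lookupᵛ)
open import Data.Vec.Properties using (≡-dec; lookup∘tabulate)
open import Effect.Monad using (RawMonad)
open import Function.Base using (_∘_; id; flip; case_of_)
open import Function.Bundles using (mk⇔; Equivalence)
open import Function.Definitions using (Injective)
open import Level using (Level; 0ℓ)
open import Relation.Binary.Core using (Rel)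
open import Relation.Binary.Definitions using (Decidable; DecidableEquality; Reflexive; Transitive; Total; tri<; tri≈; tri>)
open import Relation.Binary.PropositionalEquality using (_≡_; _≢_; refl; sym; trans; cong; cong₂; subst; subst₂; ≢-sym)
open import Relation.Nullary.Decidable using (Dec; yes; no; ¬?; _×-dec_; _⊎-dec_; _→-dec_; map′; ¬¬-excluded-middle; decidable-stable; True; toWitness; fromWitness; ⌊_⌋)
open import Relation.Nullary.Negation using (¬_; contradiction; ¬¬-Monad)
open import Relation.Unary using (Pred; _∈_; _≬_)

open Equivalence using (to; from)

private variable
  ℓ : Level
  A : Set
  m n d : ℕ

-- Dedekind reals and intervals

fromℤ-mono-< : ∀ {i j} → i ℤ.< j → fromℤ i <ℚ fromℤ j
fromℤ-mono-< {i} {j} i<j =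
  *<* (subst₂ ℤ._<_ (sym (ℤ.*-identityʳ i)) (sym (ℤ.*-identityʳ j)) i<j)

fromℤ-cancel-< : ∀ {i j} → fromℤ i <ℚ fromℤ j → i ℤ.< j
fromℤ-cancel-< {i} {j} (*<* i<j) =
  subst₂ ℤ._<_ (ℤ.*-identityʳ i) (ℤ.*-identityʳ j) i<j

ℕ⇒ℝ : ℕ → ℝ
ℕ⇒ℝ n = record
  { lower           = _<ℚ p
  ; upper           = p <ℚ_
  ; lower-inhabited = fromℤ ℤ.-[1+ 0 ] , fromℤ-mono-< ℤ.-<+
  ; upper-inhabited = fromℤ (ℤ.+ suc n) , fromℤ-mono-< (ℤ.+<+ ≤-refl)
  ; lower-rounded   = λ q → mk⇔ ℚ.<-dense (λ (r , q<r , r<p) → ℚ.<-trans q<r r<p)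
  ; upper-rounded   = λ q → mk⇔ (λ p<q → let r , p<r , r<q = ℚ.<-dense p<q in r , r<q , p<r)
                                (λ (r , r<q , p<r) → ℚ.<-trans p<r r<q)
  ; disjoint        = λ q (q<p , p<q) → ℚ.<-asym q<p p<q
  ; located         = located
  }
  where
  p = fromℤ (ℤ.+ n)
  located : ∀ {q r} → q <ℚ r → q <ℚ p ⊎ p <ℚ r
  located {q} q<r with q ℚ.<? p
  ... | yes q<p = inj₁ q<p
  ... | no  q≮p = inj₂ (ℚ.≤-<-trans (ℚ.≮⇒≥ q≮p) q<r)

ℕ⇒ℝ-mono-≤ : ∀ {m n} → m ≤ n → ℕ⇒ℝ m ≤ʳ ℕ⇒ℝ n
ℕ⇒ℝ-mono-≤ {m} {n} m≤n {q} q<m with q ℚ.<? fromℤ (ℤ.+ n)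
... | yes q<n = q<n
... | no  q≮n with fromℤ-cancel-< (ℚ.≤-<-trans (ℚ.≮⇒≥ q≮n) q<m)
...   | ℤ.+<+ n<m = contradiction m≤n (<⇒≱ n<m)

ℕ⇒ℝ-cancel-≤ : ∀ {m n} → ℕ⇒ℝ m ≤ʳ ℕ⇒ℝ n → m ≤ n
ℕ⇒ℝ-cancel-≤ m≤n = ≮⇒≥ λ n<m → ℚ.<-irrefl refl (m≤n (fromℤ-mono-< (ℤ.+<+ n<m)))

-- Roundedness of x gives a rational r of `x` above q, and locatedness of y then decides: either q
-- lies in y, or y is below r, which refutes `x ≤ʳ y`.
≤ʳ-stable : ∀ x y → ¬ ¬ (x ≤ʳ y) → x ≤ʳ y
≤ʳ-stable x y ¬¬x≤y {q} q∈x with to (ℝ.lower-rounded x q) q∈x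
... | r , q<r , r∈x with ℝ.located y q<r
...   | inj₁ q∈y = q∈y
...   | inj₂ y<r = contradiction (λ x≤y → ℝ.disjoint y r (x≤y r∈x , y<r)) ¬¬x≤y

lower<upper : ∀ x {q r} → ℝ.lower x q → ℝ.upper x r → q <ℚ r
lower<upper x {q} {r} q<x x<r with q ℚ.<? r
... | yes q<r = q<r
... | no  q≮r with ℚ.<-cmp r q
...   | tri< r<q _ _ = contradiction (from (ℝ.lower-rounded x r) (q , r<q , q<x) , x<r) (ℝ.disjoint x r)
...   | tri≈ _ refl _ = contradiction (q<x , x<r) (ℝ.disjoint x q)
...   | tri> _ _ q<r = contradiction q<r q≮r

-- Locatedness of x between q and a larger r of y leaves only one bad case, x below r; but then all
-- of x lies in y.
≰ʳ⇒≥ʳ : ∀ x y → ¬ (x ≤ʳ y) → y ≤ʳ x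
≰ʳ⇒≥ʳ x y x≰y {q} q∈y with to (ℝ.lower-rounded y q) q∈y
... | r , q<r , r∈y with ℝ.located x q<r
...   | inj₁ q∈x = q∈x
...   | inj₂ x<r = contradiction
  (λ {s} s∈x → from (ℝ.lower-rounded y s) (r , lower<upper x s∈x x<r , r∈y)) x≰y

¬¬-total : ∀ x y → ¬ ¬ (x ≤ʳ y ⊎ y ≤ʳ x)
¬¬-total x y k = k (inj₂ (≰ʳ⇒≥ʳ x y (k ∘ inj₁)))

leftEnd rightEnd : ClosedInterval → Maybe ℝ
leftEnd [ a , _ ]⟨ _ ⟩ = just a
leftEnd [ a ,∞⟩        = just a
leftEnd ⟨-∞, _ ]       = nothing
leftEnd ⟨-∞,∞⟩         = nothing
rightEnd [ _ , b ]⟨ _ ⟩ = just b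
rightEnd [ _ ,∞⟩        = nothing
rightEnd ⟨-∞, b ]       = just b
rightEnd ⟨-∞,∞⟩         = nothing

infix 4 _≤ᵉ_ _≪_

-- A missing left end is −∞ and a missing right end is +∞.
data _≤ᵉ_ : Rel (Maybe ℝ) (Level.suc 0ℓ) where
  bounded : ∀ {a b} → a ≤ʳ b → just a ≤ᵉ just b
  -∞≤_    : ∀ b → nothing ≤ᵉ b
  _≤∞     : ∀ a → a ≤ᵉ nothing

-- The interval `I` lies strictly to the left of `J`. The strict order is a negation because `_≤ᵉ_`
-- is stable, so the failure of `I ≪ J` returns an actual weak inequality.
_≪_ : Rel ClosedInterval (Level.suc 0ℓ)
I ≪ J = ¬ (leftEnd J ≤ᵉ rightEnd I)

≤ᵉ-stable : ∀ a b → ¬ ¬ (a ≤ᵉ b) → a ≤ᵉ b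
≤ᵉ-stable nothing  b        _     = -∞≤ b
≤ᵉ-stable (just a) nothing  _     = just a ≤∞
≤ᵉ-stable (just a) (just b) ¬¬a≤b =
  bounded (≤ʳ-stable a b λ a≰b → ¬¬a≤b λ { (bounded a≤b) → a≰b a≤b })

-- The chain is a′ ≤ b ≤ a ≤ b′, its middle link being the weak converse of the failed comparison.
≰ᵉ-bridge : ∀ {a b a′ b′} → ¬ (a ≤ᵉ b) → a ≤ᵉ b′ → a′ ≤ᵉ b → ¬ ¬ (a′ ≤ᵉ b′)
≰ᵉ-bridge a≰b _ (_ ≤∞)   = contradiction (_ ≤∞) a≰b
≰ᵉ-bridge a≰b _ (-∞≤ _)  k = k (-∞≤ _)
≰ᵉ-bridge a≰b (-∞≤ _) (bounded _) = contradiction (-∞≤ _) a≰b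
≰ᵉ-bridge a≰b (_ ≤∞) (bounded _) k = k (_ ≤∞)
≰ᵉ-bridge {just a} {just b} a≰b (bounded a≤b′) (bounded a′≤b) k =
  k (bounded λ q → a≤b′ (≰ʳ⇒≥ʳ a b (λ a≤b → a≰b (bounded a≤b)) (a′≤b q)))

leftEnd≤rightEnd : ∀ I → leftEnd I ≤ᵉ rightEnd I
leftEnd≤rightEnd [ _ , _ ]⟨ a≤b ⟩ = bounded a≤b
leftEnd≤rightEnd [ _ ,∞⟩          = _ ≤∞
leftEnd≤rightEnd ⟨-∞, _ ]         = -∞≤ _
leftEnd≤rightEnd ⟨-∞,∞⟩           = -∞≤ _

≪-irrefl : ∀ I → ¬ (I ≪ I)
≪-irrefl I I≪I = I≪I (leftEnd≤rightEnd I)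

-- The right end of I′ is before the left end of J′, which is at most the right end of I, which is
-- before the left end of J.
≪-ferrers : ∀ I J I′ J′ → I ≪ J → I′ ≪ J′ → ¬ (I ≪ J′) → I′ ≪ J
≪-ferrers I J I′ J′ I≪J I′≪J′ ¬I≪J′ J≤I′ = ≰ᵉ-bridge I′≪J′ J′≤I J≤I′ I≪J
  where J′≤I = ≤ᵉ-stable (leftEnd J′) (rightEnd I) ¬I≪J′

≬⇒≤ᵉ : ∀ I J → ⟦ I ⟧ ≬ ⟦ J ⟧ → leftEnd I ≤ᵉ rightEnd J
≬⇒≤ᵉ [ _ , _ ]⟨ _ ⟩ [ _ , _ ]⟨ _ ⟩ (_ , (a≤x , _) , (_ , x≤b)) = bounded (x≤b ∘ a≤x)
≬⇒≤ᵉ [ _ ,∞⟩        [ _ , _ ]⟨ _ ⟩ (_ , a≤x , (_ , x≤b))       = bounded (x≤b ∘ a≤x)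
≬⇒≤ᵉ [ _ , _ ]⟨ _ ⟩ ⟨-∞, _ ]       (_ , (a≤x , _) , x≤b)       = bounded (x≤b ∘ a≤x)
≬⇒≤ᵉ [ _ ,∞⟩        ⟨-∞, _ ]       (_ , a≤x , x≤b)             = bounded (x≤b ∘ a≤x)
≬⇒≤ᵉ _              [ _ ,∞⟩        _                           = _ ≤∞
≬⇒≤ᵉ _              ⟨-∞,∞⟩         _                           = _ ≤∞
≬⇒≤ᵉ ⟨-∞, _ ]       _              _                           = -∞≤ _
≬⇒≤ᵉ ⟨-∞,∞⟩         _              _                           = -∞≤ _

≤ᵉ⇒∈ : ∀ I {x} → leftEnd I ≤ᵉ just x → just x ≤ᵉ rightEnd I → x ∈ ⟦ I ⟧
≤ᵉ⇒∈ [ _ , _ ]⟨ _ ⟩ (bounded a≤x) (bounded x≤b) = a≤x , x≤b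
≤ᵉ⇒∈ [ _ ,∞⟩        (bounded a≤x) _             = a≤x
≤ᵉ⇒∈ ⟨-∞, _ ]       _             (bounded x≤b) = x≤b
≤ᵉ⇒∈ ⟨-∞,∞⟩         _             _             = tt

-- The larger left end is a common point; if there is none, the smaller right end.
separator : ∀ a a′ b b′ → a ≤ᵉ b → a ≤ᵉ b′ → a′ ≤ᵉ b → a′ ≤ᵉ b′ →
            ¬ ¬ (∃ λ x → (a ≤ᵉ just x × just x ≤ᵉ b) × (a′ ≤ᵉ just x × just x ≤ᵉ b′))
separator (just a) (just a′) b b′ ab ab′ a′b a′b′ k = ¬¬-total a a′ λ where
  (inj₁ a≤a′) → k (a′ , (bounded a≤a′ , a′b) , bounded id , a′b′)
  (inj₂ a′≤a) → k (a , (bounded id , ab) , bounded a′≤a , ab′)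
separator (just a) nothing   b b′ ab ab′ _ _   k = k (a , (bounded id , ab) , -∞≤ _ , ab′)
separator nothing  (just a′) b b′ _ _ a′b a′b′ k = k (a′ , (-∞≤ _ , a′b) , bounded id , a′b′)
separator nothing nothing (just b) (just b′) _ _ _ _ k = ¬¬-total b b′ λ where
  (inj₁ b≤b′) → k (b , (-∞≤ _ , bounded id) , -∞≤ _ , bounded b≤b′)
  (inj₂ b′≤b) → k (b′ , (-∞≤ _ , bounded b′≤b) , -∞≤ _ , bounded id)
separator nothing nothing (just b) nothing _ _ _ _ k = k (b , (-∞≤ _ , bounded id) , -∞≤ _ , _ ≤∞)
separator nothing nothing nothing (just b′) _ _ _ _ k = k (b′ , (-∞≤ _ , _ ≤∞) , -∞≤ _ , bounded id)
-- Without any end both intervals are the whole line, and 0 is an arbitrary point of it.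
separator nothing nothing nothing nothing _ _ _ _ k = k (ℕ⇒ℝ 0 , (-∞≤ _ , _ ≤∞) , -∞≤ _ , _ ≤∞)

¬≪⇒¬¬≬ : ∀ I J → ¬ (I ≪ J) → ¬ (J ≪ I) → ¬ ¬ (⟦ I ⟧ ≬ ⟦ J ⟧)
¬≪⇒¬¬≬ I J ¬I≪J ¬J≪I k = separator _ _ _ _
  (leftEnd≤rightEnd I) (≤ᵉ-stable _ _ ¬J≪I) (≤ᵉ-stable _ _ ¬I≪J) (leftEnd≤rightEnd J)
  λ (x , (p , q) , (p′ , q′)) → k (x , ≤ᵉ⇒∈ I p q , ≤ᵉ⇒∈ J p′ q′)

-- Interval representations of finite graphs

-- Irreflexivity and the Ferrers property (no 2+2) characterise interval orders, so no endpoints are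
-- mentioned. Boolean values make the record accessible to finite search.
record IntervalOrders (G : Graph) (d : ℕ) : Set where
  open Graph G
  field
    before : Fin d → Vertex → Vertex → Bool

  _≺[_]_ : Vertex → Fin d → Vertex → Set
  u ≺[ i ] v = T (before i u v)

  field
    ≺-irrefl  : ∀ i u → ¬ (u ≺[ i ] u)
    ≺-ferrers : ∀ i u v u′ v′ → u ≺[ i ] v → u′ ≺[ i ] v′ → u ≺[ i ] v′ ⊎ u′ ≺[ i ] v
    sound     : ∀ i u v → u ≺[ i ] v → ¬ (u ~ v)
    complete  : ∀ u v → u ≢ v → ¬ (u ~ v) → ∃ λ i → u ≺[ i ] v ⊎ v ≺[ i ] u

-- Two closed intervals intersect when each left end is at most the other right end. `sound` states
-- one of the two inequalities; exchanging u and v gives the other.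
record EndpointRepresentation (G : Graph) (d : ℕ) : Set where
  open Graph G
  field
    left right : Fin d → Vertex → ℕ
    left≤right : ∀ i u → left i u ≤ right i u
    sound      : ∀ i u v → u ~ v → left i u ≤ right i v
    complete   : ∀ u v → u ≢ v → ¬ (u ~ v) → ∃ λ i → right i u < left i v ⊎ right i v < left i u

-- Exhaustive search, double negation over finite sets, and counting in lists

Searchable : Set → Set₁
Searchable A = ∀ {P : Pred A 0ℓ} → (∀ a → Dec (P a)) → Dec (∃ P)

searchBool : Searchable Bool
searchBool P? = map′
  [ (λ p → true , p) , (λ p → false , p) ] (λ { (true , p) → inj₁ p ; (false , p) → inj₂ p })
  (P? true ⊎-dec P? false)

searchVec : Searchable A → ∀ n → Searchable (Vec A n)
searchVec search zero    P? = map′ ([] ,_) (λ { ([] , p) → p }) (P? [])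
searchVec search (suc n) P? = map′
  (λ (x , xs , p) → x ∷ xs , p) (λ { (x ∷ xs , p) → x , xs , p })
  (search λ x → searchVec search n λ xs → P? (x ∷ xs))

¬¬-∀Fin : {P : Fin n → Set ℓ} → (∀ i → ¬ ¬ P i) → ¬ ¬ (∀ i → P i)
¬¬-∀Fin = sequence (RawMonad.rawApplicative ¬¬-Monad)

length-filter-⊆ : ∀ {P Q : Pred A 0ℓ} (P? : ∀ x → Dec (P x)) (Q? : ∀ x → Dec (Q x)) →
  (∀ {x} → P x → Q x) → ∀ xs → length (filter P? xs) ≤ length (filter Q? xs)
length-filter-⊆ P? Q? P⊆Q []       = z≤n
length-filter-⊆ P? Q? P⊆Q (x ∷ xs) with P? x | Q? x
... | yes _ | yes _ = s≤s (length-filter-⊆ P? Q? P⊆Q xs)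
... | yes p | no ¬q = contradiction (P⊆Q p) ¬q
... | no  _ | yes _ = m≤n⇒m≤1+n (length-filter-⊆ P? Q? P⊆Q xs)
... | no  _ | no  _ = length-filter-⊆ P? Q? P⊆Q xs

length-filter-⊂ : ∀ {P Q : Pred A 0ℓ} (P? : ∀ x → Dec (P x)) (Q? : ∀ x → Dec (Q x)) →
  (∀ {x} → P x → Q x) → ∀ {xs y} → y ∈ˡ xs → ¬ P y → Q y →
  length (filter P? xs) < length (filter Q? xs)
length-filter-⊂ P? Q? P⊆Q {x ∷ xs} (here refl) ¬p q with P? x | Q? x
... | yes p | _     = contradiction p ¬p
... | no  _ | no ¬q = contradiction q ¬q
... | no  _ | yes _ = s≤s (length-filter-⊆ P? Q? P⊆Q xs)
length-filter-⊂ P? Q? P⊆Q {x ∷ xs} (there y∈xs) ¬p q with P? x | Q? x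
... | yes _ | yes _ = s≤s (length-filter-⊂ P? Q? P⊆Q y∈xs ¬p q)
... | yes p | no ¬q = contradiction (P⊆Q p) ¬q
... | no  _ | yes _ = m≤n⇒m≤1+n (length-filter-⊂ P? Q? P⊆Q y∈xs ¬p q)
... | no  _ | no  _ = length-filter-⊂ P? Q? P⊆Q y∈xs ¬p q

-- Boxes, endpoints and interval orders of a finite graph

module FiniteGraph
  (G : Graph)
  (_≟_ : DecidableEquality (Graph.Vertex G)) (_~?_ : Decidable (Graph._~_ G))
  (vertices : List (Graph.Vertex G)) (allVertices : ∀ v → v ∈ˡ vertices)
  where
  open Graph G

  ∀? : ∀ {P : Pred Vertex 0ℓ} → (∀ v → Dec (P v)) → Dec (∀ v → P v)
  ∀? P? = map′ (λ p v → All.lookup p (allVertices v)) (λ p → All.tabulate λ {v} _ → p v) (All.all? P? vertices)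

  ¬¬-∀ : {P : Pred Vertex ℓ} → (∀ v → ¬ ¬ P v) → ¬ ¬ (∀ v → P v)
  ¬¬-∀ {P = P} ¬¬p k = ¬¬-∀Fin (¬¬p ∘ lookup vertices) λ p →
    k λ v → subst P (sym (lookup-index (allVertices v))) (p (index (allVertices v)))

  endpoints⇒boxes : EndpointRepresentation G d → HasBoxRepresentation G d
  endpoints⇒boxes {d} E = box , λ {u} {v} u≢v → mk⇔ meet (adjacent u≢v)
    where
    open EndpointRepresentation E
    box : Vertex → Box d
    box v i = [ ℕ⇒ℝ (left i v) , ℕ⇒ℝ (right i v) ]⟨ ℕ⇒ℝ-mono-≤ (left≤right i v) ⟩

    meet : ∀ {u v} → u ~ v → ⟦ box u ⟧ᴮ ≬ ⟦ box v ⟧ᴮ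
    -- In each coordinate the larger of the two left ends is a common point.
    meet {u} {v} u~v = (λ i → ℕ⇒ℝ (left i u ⊔ left i v)) ,
      (λ i → ℕ⇒ℝ-mono-≤ (m≤m⊔n _ _) ,
             ℕ⇒ℝ-mono-≤ (⊔-lub (left≤right i u) (sound i v u (~-sym u~v)))) ,
      (λ i → ℕ⇒ℝ-mono-≤ (m≤n⊔m _ _) ,
             ℕ⇒ℝ-mono-≤ (⊔-lub (sound i u v u~v) (left≤right i v)))

    adjacent : ∀ {u v} → u ≢ v → ⟦ box u ⟧ᴮ ≬ ⟦ box v ⟧ᴮ → u ~ v
    adjacent {u} {v} u≢v (x , x∈u , x∈v) = decidable-stable (u ~? v) λ u≁v →
      let i , r<l = complete u v u≢v u≁v in
      [ (λ r<l → <⇒≱ r<l (ℕ⇒ℝ-cancel-≤ λ q → proj₂ (x∈u i) (proj₁ (x∈v i) q)))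
      , (λ r<l → <⇒≱ r<l (ℕ⇒ℝ-cancel-≤ λ q → proj₂ (x∈v i) (proj₁ (x∈u i) q))) ] r<l

  orders⇒endpoints : IntervalOrders G d → EndpointRepresentation G d
  orders⇒endpoints O = record
    { left = left ; right = right ; left≤right = λ i u → ¬≺⇒≤ i u u (≺-irrefl i u)
    ; sound = λ i u v u~v → ¬≺⇒≤ i v u λ v≺u → sound i v u v≺u (~-sym u~v)
    ; complete = λ u v u≢v u≁v → let i , c = complete u v u≢v u≁v in
        i , Sum.map (≺⇒< i u v) (≺⇒< i v u) c
    }
    where
    open IntervalOrders O
    pred? : ∀ i v u → Dec (u ≺[ i ] v)
    pred? i v u = T? (before i u v)
    left right : _ → _ → ℕ
    left i v = length (filter (pred? i v) vertices)
    -- Predecessor sets are nested, and those of the elements after u are strictly larger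
    -- than those of the elements not after u.
    right i u = max 0 (List.map (left i) (filter (λ v → ¬? (pred? i v u)) vertices))

    ¬≺⇒≤ : ∀ i u v → ¬ (u ≺[ i ] v) → left i v ≤ right i u
    ¬≺⇒≤ i u v u⊀v = All.lookup (xs≤max 0 _)
      (∈-map⁺ (left i)
        (∈-filter⁺ (λ v → ¬? (pred? i v u)) (allVertices v) u⊀v))

    left-mono-< : ∀ i u v w → u ≺[ i ] v → ¬ (u ≺[ i ] w) → left i w < left i v
    left-mono-< i u v w u≺v u⊀w = length-filter-⊂ (pred? i w) (pred? i v)
      (λ {t} t≺w → [ (λ u≺w → contradiction u≺w u⊀w) , id ] (≺-ferrers i u v t w u≺v t≺w))
      (allVertices u) u⊀w u≺v

    ≺⇒< : ∀ i u v → u ≺[ i ] v → right i u < left i v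
    -- The default 0 of `max` must also be below `left i v`. It is, because u precedes v but not
    -- itself, so `left i u` is already smaller.
    ≺⇒< i u v u≺v = max<v⁺ (≤-<-trans z≤n (left-mono-< i u v u u≺v (≺-irrefl i u)))
      (All.map⁺ (All.map (λ {w} → left-mono-< i u v w u≺v)
        (All.all-filter (λ v → ¬? (pred? i v u)) vertices)))

  -- Real endpoints cannot be compared effectively, but only finitely many comparisons occur, so
  -- under a double negation all of them may be taken as decided.
  boxes⇒¬¬orders : HasBoxRepresentation G d → ¬ ¬ IntervalOrders G d
  boxes⇒¬¬orders {d} (box , represents) k =
    ¬¬-∀Fin (λ i → ¬¬-∀ λ u → ¬¬-∀ λ v → ¬¬-excluded-middle {A = box u i ≪ box v i}) λ ≪? →
    let before = λ i u v → ⌊ ≪? i u v ⌋ in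
    k record
      { before    = before
      ; ≺-irrefl  = λ i u u≺u → ≪-irrefl (box u i) (toWitness u≺u)
      ; ≺-ferrers = λ i u v u′ v′ p q → ferrers {≪? = ≪?} i u v u′ v′ p q
      ; sound     = λ i u v u≺v u~v →
          let x , x∈u , x∈v = to (represents λ u≡v → ~-irrefl u≡v u~v) u~v in
          toWitness u≺v (≬⇒≤ᵉ (box v i) (box u i) (x i , x∈v i , x∈u i))
      ; complete  = λ u v u≢v u≁v → decidable-stable
          (any? λ i → T? (before i u v) ⊎-dec T? (before i v u)) λ incomparable →
          -- If u and v are comparable in no coordinate, their intervals meet in every one. The
          -- common points form a point of both boxes, so u and v would be adjacent.
          ¬¬-∀Fin (λ i → ¬≪⇒¬¬≬ (box u i) (box v i)
              (λ u≪v → incomparable (i , inj₁ (fromWitness u≪v)))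
              (λ v≪u → incomparable (i , inj₂ (fromWitness v≪u))))
            λ meet → u≁v (from (represents u≢v)
              (proj₁ ∘ meet , proj₁ ∘ proj₂ ∘ meet , proj₂ ∘ proj₂ ∘ meet))
      }
    where
    ferrers : ∀ {≪? : ∀ i u v → Dec (box u i ≪ box v i)} i u v u′ v′ →
      True (≪? i u v) → True (≪? i u′ v′) → True (≪? i u v′) ⊎ True (≪? i u′ v)
    ferrers {≪?} i u v u′ v′ u≺v u′≺v′ with ≪? i u v′
    ... | yes u≪v′ = inj₁ _
    ... | no ¬u≪v′ = inj₂ (fromWitness
      (≪-ferrers (box u i) (box v i) (box u′ i) (box v′ i) (toWitness u≺v) (toWitness u′≺v′) ¬u≪v′))

  IsOrders : (Fin d → Vertex → Vertex → Bool) → Set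
  IsOrders before =
    (∀ i u → ¬ T (before i u u)) ×
    (∀ i u v u′ v′ → T (before i u v) → T (before i u′ v′) → T (before i u v′) ⊎ T (before i u′ v)) ×
    (∀ i u v → T (before i u v) → ¬ (u ~ v)) ×
    (∀ u v → u ≢ v → ¬ (u ~ v) → ∃ λ i → T (before i u v) ⊎ T (before i v u))

  isOrders? : (before : Fin d → Vertex → Vertex → Bool) → Dec (IsOrders before)
  isOrders? before =
    (all? λ i → ∀? λ u → ¬? (T? (before i u u)))
    ×-dec (all? λ i → ∀? λ u → ∀? λ v → ∀? λ u′ → ∀? λ v′ →
      T? (before i u v) →-dec T? (before i u′ v′) →-dec (T? (before i u v′) ⊎-dec T? (before i u′ v)))
    ×-dec (all? λ i → ∀? λ u → ∀? λ v → T? (before i u v) →-dec ¬? (u ~? v))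
    ×-dec (∀? λ u → ∀? λ v → ¬? (u ≟ v) →-dec ¬? (u ~? v) →-dec
      any? λ i → T? (before i u v) ⊎-dec T? (before i v u))

  -- Needed because a relation and its tabulation as a matrix agree only pointwise.
  isOrders-resp : {f g : Fin d → Vertex → Vertex → Bool} → (∀ i u v → f i u v ≡ g i u v) →
                  IsOrders f → IsOrders g
  isOrders-resp {f = f} {g} f≡g (p , q , r , s) =
    (λ i u → p i u ∘ ⇐) ,
    (λ i u v u′ v′ x y → Sum.map ⇒ ⇒ (q i u v u′ v′ (⇐ x) (⇐ y))) ,
    (λ i u v → r i u v ∘ ⇐) ,
    (λ u v u≢v u≁v → let i , c = s u v u≢v u≁v in i , Sum.map ⇒ ⇒ c)
    where
    ⇒ : ∀ {i u v} → T (f i u v) → T (g i u v)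
    ⇒ = subst T (f≡g _ _ _)
    ⇐ : ∀ {i u v} → T (g i u v) → T (f i u v)
    ⇐ = subst T (sym (f≡g _ _ _))

  -- Every vertex has a position in the list `vertices`, so d relations amount to d square Boolean
  -- matrices, of which there are finitely many.
  orders? : ∀ d → Dec (IntervalOrders G d)
  orders? d = map′
    (λ (m , p , q , r , s) → record
      { before = entry m ; ≺-irrefl = p ; ≺-ferrers = q ; sound = r ; complete = s })
    (λ O → let open IntervalOrders O in
      matrix before ,
      isOrders-resp (λ i u v → sym (entry∘matrix before i u v)) (≺-irrefl , ≺-ferrers , sound , complete))
    (searchVec (searchVec (searchVec searchBool N) N) d (isOrders? ∘ entry))
    where
    N = length vertices
    position : Vertex → Fin N
    position v = index (allVertices v)

    entry : Vec (Vec (Vec Bool N) N) d → Fin d → Vertex → Vertex → Bool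
    entry m i u v = lookupᵛ (lookupᵛ (lookupᵛ m i) (position u)) (position v)

    matrix : (Fin d → Vertex → Vertex → Bool) → Vec (Vec (Vec Bool N) N) d
    matrix f = tabulate λ i → tabulate λ j → tabulate λ k → f i (lookup vertices j) (lookup vertices k)

    entry∘matrix : ∀ f i u v → entry (matrix f) i u v ≡ f i u v
    entry∘matrix f i u v
      rewrite lookup∘tabulate (λ i → tabulate λ j → tabulate λ k → f i (lookup vertices j) (lookup vertices k)) i
            | lookup∘tabulate (λ j → tabulate λ k → f i (lookup vertices j) (lookup vertices k)) (position u)
            | lookup∘tabulate (λ k → f i (lookup vertices (position u)) (lookup vertices k)) (position v)
            | sym (lookup-index (allVertices u)) | sym (lookup-index (allVertices v)) = refl

  -- Boxes give orders only up to double negation; `orders?` removes it.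
  boxes? : ∀ d → Dec (HasBoxRepresentation G d)
  boxes? d = map′ (endpoints⇒boxes ∘ orders⇒endpoints)
    (λ B → decidable-stable (orders? d) (boxes⇒¬¬orders B)) (orders? d)

-- The vertices of Kn(2,n)

Vertex : ℕ → Set
Vertex n = Graph.Vertex (Kn 2 n)

_~_ : Vertex n → Vertex n → Set
_~_ {n} = Graph._~_ (Kn 2 n)

vertex-≡ : {u v : Vertex n} → proj₁ u ≡ proj₁ v → u ≡ v
vertex-≡ {u = s , _} {v = .s , _} refl = cong (s ,_) (≡-irrelevant _ _)

_≟ᵛ_ : DecidableEquality (Vertex n)
u ≟ᵛ v = map′ vertex-≡ (cong proj₁) (≡-dec Bool._≟_ (proj₁ u) (proj₁ v))

_~?_ : Decidable (_~_ {n})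
u ~? v = ¬? (nonempty? (proj₁ u ∩ proj₁ v))

∣p∣≡0⇒p≡∅ : ∀ (p : Subset n) → ∣ p ∣ ≡ 0 → p ≡ ∅
∣p∣≡0⇒p≡∅ []            _  = refl
∣p∣≡0⇒p≡∅ (outside ∷ p) eq = cong (outside ∷_) (∣p∣≡0⇒p≡∅ p eq)

∣p∣≡1⇒singleton : ∀ (p : Subset n) → ∣ p ∣ ≡ 1 → ∃ λ x → p ≡ ⁅ x ⁆
∣p∣≡1⇒singleton (inside  ∷ p) eq = zero , cong (inside ∷_) (∣p∣≡0⇒p≡∅ p (suc-injective eq))
∣p∣≡1⇒singleton (outside ∷ p) eq = let x , p≡⁅x⁆ = ∣p∣≡1⇒singleton p eq in
  suc x , cong (outside ∷_) p≡⁅x⁆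

∣p∣≡2⇒pair : ∀ (p : Subset n) → ∣ p ∣ ≡ 2 → ∃₂ λ x y → x ≢ y × p ≡ ⁅ x ⁆ ∪ ⁅ y ⁆
∣p∣≡2⇒pair (inside  ∷ p) eq = let y , p≡⁅y⁆ = ∣p∣≡1⇒singleton p (suc-injective eq) in
  zero , suc y , (λ ()) , cong (inside ∷_) (trans p≡⁅y⁆ (sym (∪-identityˡ _)))
∣p∣≡2⇒pair (outside ∷ p) eq = let x , y , x≢y , p≡xy = ∣p∣≡2⇒pair p eq in
  suc x , suc y , x≢y ∘ Fin.suc-injective , cong (outside ∷_) p≡xy

∣pair∣≡2 : ∀ {x y : Fin n} → x ≢ y → ∣ ⁅ x ⁆ ∪ ⁅ y ⁆ ∣ ≡ 2
∣pair∣≡2 {x = zero}  {zero}  x≢y = contradiction refl x≢y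
∣pair∣≡2 {x = zero}  {suc y} x≢y = cong suc (trans (cong ∣_∣ (∪-identityˡ ⁅ y ⁆)) (∣⁅x⁆∣≡1 y))
∣pair∣≡2 {x = suc x} {zero}  x≢y = cong suc (trans (cong ∣_∣ (∪-identityʳ ⁅ x ⁆)) (∣⁅x⁆∣≡1 x))
∣pair∣≡2 {x = suc x} {suc y} x≢y = ∣pair∣≡2 (x≢y ∘ cong suc)

edge : {x y : Fin n} → x ≢ y → Vertex n
edge {x = x} {y} x≢y = ⁅ x ⁆ ∪ ⁅ y ⁆ , ∣pair∣≡2 x≢y

infix 4 _∈ᵛ_
_∈ᵛ_ : Fin n → Vertex n → Set
x ∈ᵛ v = x ∈ˢ proj₁ v

∈-edgeˡ : {x y : Fin n} (x≢y : x ≢ y) → x ∈ᵛ edge x≢y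
∈-edgeˡ _ = x∈p∪q⁺ (inj₁ (x∈⁅x⁆ _))

∈-edgeʳ : {x y : Fin n} (x≢y : x ≢ y) → y ∈ᵛ edge x≢y
∈-edgeʳ _ = x∈p∪q⁺ (inj₂ (x∈⁅x⁆ _))

∈-edge⁻ : {x y z : Fin n} (x≢y : x ≢ y) → z ∈ᵛ edge x≢y → z ≡ x ⊎ z ≡ y
∈-edge⁻ x≢y = Sum.map (x∈⁅y⁆⇒x≡y _) (x∈⁅y⁆⇒x≡y _) ∘ x∈p∪q⁻ _ _

ends : ∀ (v : Vertex n) → ∃₂ λ x y → ∃ λ (x≢y : x ≢ y) → v ≡ edge x≢y
ends (p , ∣p∣≡2) = let x , y , x≢y , p≡xy = ∣p∣≡2⇒pair p ∣p∣≡2 in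
  x , y , x≢y , vertex-≡ p≡xy

edge-comm : {x y : Fin n} (x≢y : x ≢ y) (y≢x : y ≢ x) → edge x≢y ≡ edge y≢x
edge-comm _ _ = vertex-≡ (∪-comm _ _)

edge-cong : {x y z w : Fin n} (x≢y : x ≢ y) (z≢w : z ≢ w) → x ≡ z → y ≡ w → edge x≢y ≡ edge z≢w
edge-cong _ _ refl refl = vertex-≡ refl

edge-∋ : ∀ (v : Vertex n) {x} → x ∈ᵛ v → ∃ λ y → ∃ λ (x≢y : x ≢ y) → v ≡ edge x≢y
edge-∋ v x∈v with ends v
... | p , q , p≢q , refl with ∈-edge⁻ p≢q x∈v
...   | inj₁ refl = q , p≢q , refl
...   | inj₂ refl = p , ≢-sym p≢q , edge-comm _ _

common⇒≁ : ∀ (u v : Vertex n) {x} → x ∈ᵛ u → x ∈ᵛ v → ¬ (u ~ v)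
common⇒≁ u v x∈u x∈v u~v = u~v (_ , x∈p∩q⁺ (x∈u , x∈v))

≁⇒common : ∀ (u v : Vertex n) → ¬ (u ~ v) → ∃ λ x → x ∈ᵛ u × x ∈ᵛ v
≁⇒common u v u≁v with nonempty? (proj₁ u ∩ proj₁ v)
... | yes (x , x∈) = x , x∈p∩q⁻ (proj₁ u) (proj₁ v) x∈
... | no  empty    = contradiction empty u≁v

-- As `punchIn x` runs through the points other than x, each edge is listed twice, once from each
-- end.
vertices : ∀ n → List (Vertex (suc n))
vertices n = List.map (λ (x , y) → edge (≢-sym (punchInᵢ≢i x y)))
                      (cartesianProduct (allFin (suc n)) (allFin n))

allVertices : ∀ (v : Vertex (suc n)) → v ∈ˡ vertices n
allVertices v with ends v
... | x , y , x≢y , refl = subst (_∈ˡ _)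
  (edge-cong _ _ refl (punchIn-punchOut x≢y))
  (∈-map⁺ _ (∈-cartesianProduct⁺ (∈-allFin x) (∈-allFin (punchOut x≢y))))

-- The upper bound: stars at all vertices but two

module Stars (k : ℕ) where

  first final : Fin (3 + k)
  first = zero
  final = fromℕ (2 + k)

  centre : Fin (1 + k) → Fin (3 + k)
  centre i = suc (inject₁ i)

  data Position : Fin (3 + k) → Set where
    isFirst  : Position first
    isCentre : ∀ i → Position (centre i)
    isFinal  : Position final

  position : ∀ x → Position x
  position zero = isFirst
  position (suc x) with view x
  ... | ‵fromℕ     = isFinal
  ... | ‵inject₁ i = isCentre i

  -- Total in v, so that endpoints can be defined for every edge: if x is not in v, some end of v is
  -- returned and the uniqueness clause is vacuous.
  otherEnd : ∀ x (v : Vertex (3 + k)) → ∃ λ y → y ∈ᵛ v × (∀ {z} → x ∈ᵛ v → z ∈ᵛ v → z ≢ x → y ≡ z)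
  otherEnd x v with ends v
  ... | p , q , p≢q , refl with p ≟ x
  ...   | yes refl = q , ∈-edgeʳ p≢q , λ _ z∈v z≢x →
          [ (λ z≡p → contradiction z≡p z≢x) , sym ] (∈-edge⁻ p≢q z∈v)
  ...   | no  p≢x  = p , ∈-edgeˡ p≢q , λ x∈v z∈v z≢x → unique (∈-edge⁻ p≢q x∈v) (∈-edge⁻ p≢q z∈v) z≢x
    where
    unique : ∀ {z} → x ≡ p ⊎ x ≡ q → z ≡ p ⊎ z ≡ q → z ≢ x → p ≡ z
    unique (inj₁ x≡p) _          _   = contradiction (sym x≡p) p≢x
    unique (inj₂ x≡q) (inj₁ z≡p) _   = sym z≡p
    unique (inj₂ x≡q) (inj₂ z≡q) z≢x = contradiction (trans z≡q (sym x≡q)) z≢x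

  other : Fin (3 + k) → Vertex (3 + k) → Fin (3 + k)
  other x v = proj₁ (otherEnd x v)

  other-∈ : ∀ x (v : Vertex (3 + k)) → other x v ∈ᵛ v
  other-∈ x v = proj₁ (proj₂ (otherEnd x v))

  other-unique : ∀ {x y} (v : Vertex (3 + k)) → x ∈ᵛ v → y ∈ᵛ v → y ≢ x → other x v ≡ y
  other-unique {x} v = proj₂ (proj₂ (otherEnd x v))

  -- In coordinate i the edges at centre i are points in the order of their other end,
  -- and every other edge meets all of them, except that it avoids the extreme points
  -- first and final if it contains that vertex.
  left right : Fin (1 + k) → Vertex (3 + k) → ℕ
  left i v with centre i ∈? proj₁ v
  ... | yes _ = toℕ (other (centre i) v)
  ... | no  _ with first ∈? proj₁ v
  ...   | yes _ = 1
  ...   | no  _ = 0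
  right i v with centre i ∈? proj₁ v
  ... | yes _ = toℕ (other (centre i) v)
  ... | no  _ with final ∈? proj₁ v
  ...   | yes _ = 1 + k
  ...   | no  _ = 2 + k

  left≤right : ∀ i v → left i v ≤ right i v
  left≤right i v with centre i ∈? proj₁ v
  ... | yes _ = ≤-refl
  ... | no  _ with first ∈? proj₁ v | final ∈? proj₁ v
  ...   | yes _ | yes _ = s≤s z≤n
  ...   | yes _ | no  _ = s≤s z≤n
  ...   | no  _ | yes _ = z≤n
  ...   | no  _ | no  _ = z≤n

  toℕ≤1+k : ∀ {x} → x ≢ final → toℕ x ≤ 1 + k
  toℕ≤1+k {x} x≢final = m<1+n⇒m≤n (≤∧≢⇒< (toℕ≤pred[n] x)
    λ eq → x≢final (toℕ-injective (trans eq (sym (toℕ-fromℕ (2 + k))))))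

  1≤toℕ : ∀ {x} → x ≢ first → 1 ≤ toℕ x
  1≤toℕ {zero}  0≢0 = contradiction refl 0≢0
  1≤toℕ {suc _} _   = s≤s z≤n

  sound : ∀ i u v → u ~ v → left i u ≤ right i v
  sound i u v u~v with centre i ∈? proj₁ u | centre i ∈? proj₁ v
  ... | yes c∈u | yes c∈v = contradiction u~v (common⇒≁ u v c∈u c∈v)
  ... | yes _ | no _ with final ∈? proj₁ v
  -- As u is disjoint from v, the other end of u is not `final`, so its point does not exceed the
  -- shortened right end `1 + k`. The case of `first` below is the mirror image.
  ...   | yes final∈v = toℕ≤1+k λ eq →
          common⇒≁ u v (subst (_∈ᵛ u) eq (other-∈ (centre i) u)) final∈v u~v
  ...   | no _ = toℕ≤pred[n] (other (centre i) u)
  sound i u v u~v | no _ | yes _ with first ∈? proj₁ u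
  ...   | yes first∈u = 1≤toℕ λ eq →
          common⇒≁ u v first∈u (subst (_∈ᵛ v) eq (other-∈ (centre i) v)) u~v
  ...   | no _ = z≤n
  sound i u v u~v | no _ | no _ with first ∈? proj₁ u | final ∈? proj₁ v
  ...   | yes _ | yes _ = s≤s z≤n
  ...   | yes _ | no  _ = s≤s z≤n
  ...   | no  _ | yes _ = z≤n
  ...   | no  _ | no  _ = z≤n

  left-centre : ∀ i {x} v → centre i ∈ᵛ v → x ∈ᵛ v → x ≢ centre i → left i v ≡ toℕ x
  left-centre i v c∈v x∈v x≢c with centre i ∈? proj₁ v
  ... | yes _  = cong toℕ (other-unique v c∈v x∈v x≢c)
  ... | no c∉v = contradiction c∈v c∉v

  right-centre : ∀ i {x} v → centre i ∈ᵛ v → x ∈ᵛ v → x ≢ centre i → right i v ≡ toℕ x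
  right-centre i v c∈v x∈v x≢c with centre i ∈? proj₁ v
  ... | yes _  = cong toℕ (other-unique v c∈v x∈v x≢c)
  ... | no c∉v = contradiction c∈v c∉v

  left-first : ∀ i v → ¬ (centre i ∈ᵛ v) → first ∈ᵛ v → left i v ≡ 1
  left-first i v c∉v first∈v with centre i ∈? proj₁ v
  ... | yes c∈v = contradiction c∈v c∉v
  ... | no  _ with first ∈? proj₁ v
  ...   | yes _       = refl
  ...   | no  first∉v = contradiction first∈v first∉v

  right-final : ∀ i v → ¬ (centre i ∈ᵛ v) → final ∈ᵛ v → right i v ≡ 1 + k
  right-final i v c∉v final∈v with centre i ∈? proj₁ v
  ... | yes c∈v = contradiction c∈v c∉v
  ... | no  _ with final ∈? proj₁ v
  ...   | yes _       = refl
  ...   | no  final∉v = contradiction final∈v final∉v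

  _separates_and_ : Fin (1 + k) → Vertex (3 + k) → Vertex (3 + k) → Set
  i separates u and v = right i u < left i v ⊎ right i v < left i u

  separate-at-centre : ∀ i {y z} (x≢y : centre i ≢ y) (x≢z : centre i ≢ z) → y ≢ z →
                       i separates edge x≢y and edge x≢z
  separate-at-centre i {y} {z} x≢y x≢z y≢z
    rewrite left-centre i (edge x≢y) (∈-edgeˡ x≢y) (∈-edgeʳ x≢y) (≢-sym x≢y)
          | left-centre i (edge x≢z) (∈-edgeˡ x≢z) (∈-edgeʳ x≢z) (≢-sym x≢z)
          | right-centre i (edge x≢y) (∈-edgeˡ x≢y) (∈-edgeʳ x≢y) (≢-sym x≢y)
          | right-centre i (edge x≢z) (∈-edgeˡ x≢z) (∈-edgeʳ x≢z) (≢-sym x≢z)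
    with <-cmp (toℕ y) (toℕ z)
  ... | tri< y<z _ _ = inj₁ y<z
  ... | tri≈ _ eq _  = contradiction (toℕ-injective eq) y≢z
  ... | tri> _ _ z<y = inj₂ z<y

  ∉-edge : ∀ {x y z : Fin (3 + k)} (x≢y : x ≢ y) → z ≢ x → z ≢ y → ¬ (z ∈ᵛ edge x≢y)
  ∉-edge x≢y z≢x z≢y = [ z≢x , z≢y ] ∘ ∈-edge⁻ x≢y

  -- The edge from `first` to the centre is the point 0, and the other edge at `first` starts at 1.
  separate-at-first : ∀ i {z} (x≢c : first ≢ centre i) (x≢z : first ≢ z) → centre i ≢ z →
                      right i (edge x≢c) < left i (edge x≢z)
  separate-at-first i x≢c x≢z c≢z
    rewrite right-centre i (edge x≢c) (∈-edgeʳ x≢c) (∈-edgeˡ x≢c) x≢c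
          | left-first i (edge x≢z) (∉-edge x≢z (≢-sym x≢c) c≢z) (∈-edgeˡ x≢z) = ≤-refl

  -- The edge from `final` to the centre is the point `2 + k`, and the other edge at `final` stops
  -- at `1 + k`.
  separate-at-final : ∀ i {z} (x≢c : final ≢ centre i) (x≢z : final ≢ z) → centre i ≢ z →
                      right i (edge x≢z) < left i (edge x≢c)
  separate-at-final i x≢c x≢z c≢z
    rewrite left-centre i (edge x≢c) (∈-edgeʳ x≢c) (∈-edgeˡ x≢c) x≢c
          | right-final i (edge x≢z) (∉-edge x≢z (≢-sym x≢c) c≢z) (∈-edgeˡ x≢z)
          | toℕ-fromℕ k = ≤-refl

  -- If x is a centre, its own coordinate works. Otherwise x is `first` or `final`, and since only
  -- one further vertex is not a centre, y or z is a centre whose coordinate works.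
  separated : ∀ {x y z} (x≢y : x ≢ y) (x≢z : x ≢ z) → y ≢ z →
              ∃ λ i → i separates edge x≢y and edge x≢z
  separated {x} {y} {z} x≢y x≢z y≢z with position x | position y | position z
  ... | isCentre i | _          | _          = i , separate-at-centre i x≢y x≢z y≢z
  ... | isFirst    | isFirst    | _          = contradiction refl x≢y
  ... | isFirst    | isCentre i | _          = i , inj₁ (separate-at-first i x≢y x≢z y≢z)
  ... | isFirst    | isFinal    | isFirst    = contradiction refl x≢z
  ... | isFirst    | isFinal    | isCentre i = i , inj₂ (separate-at-first i x≢z x≢y (≢-sym y≢z))
  ... | isFirst    | isFinal    | isFinal    = contradiction refl y≢z
  ... | isFinal    | isFinal    | _          = contradiction refl x≢y
  ... | isFinal    | isCentre i | _          = i , inj₂ (separate-at-final i x≢y x≢z y≢z)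
  ... | isFinal    | isFirst    | isFinal    = contradiction refl x≢z
  ... | isFinal    | isFirst    | isCentre i = i , inj₁ (separate-at-final i x≢z x≢y (≢-sym y≢z))
  ... | isFinal    | isFirst    | isFirst    = contradiction refl y≢z

  complete : ∀ u v → u ≢ v → ¬ (u ~ v) → ∃ λ i → i separates u and v
  complete u v u≢v u≁v with ≁⇒common u v u≁v
  ... | x , x∈u , x∈v with edge-∋ u x∈u | edge-∋ v x∈v
  ...   | y , x≢y , refl | z , x≢z , refl =
    separated x≢y x≢z λ { refl → u≢v (edge-cong _ _ refl refl) }

  representation : EndpointRepresentation (Kn 2 (3 + k)) (1 + k)
  representation = record
    { left = left ; right = right ; left≤right = left≤right ; sound = sound ; complete = complete }

-- Interval orders on the edges of the complete graph

-- (x , y) and (y , x) both stand for the edge {x,y} of the complete graph on Fin n.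
Pair : ℕ → Set
Pair n = Fin n × Fin n

-- An interval order on edges whose comparable edges intersect. The swap fields make it independent
-- of the order of the ends, and the proper fields keep degenerate pairs (x , x) incomparable to
-- everything. With pairs in place of subsets, deleting a vertex is a mere relabelling.
record EdgeOrder (n : ℕ) : Set₁ where
  infix 4 _≺_
  field
    _≺_     : Rel (Pair n) 0ℓ
    _≺?_    : Decidable _≺_
    irrefl  : ∀ {e} → ¬ (e ≺ e)
    ferrers : ∀ {e f e′ f′} → e ≺ f → e′ ≺ f′ → e ≺ f′ ⊎ e′ ≺ f
    swapˡ   : ∀ {x y e} → (x , y) ≺ e → (y , x) ≺ e
    swapʳ   : ∀ {x y e} → e ≺ (x , y) → e ≺ (y , x)
    properˡ : ∀ {x y e} → (x , y) ≺ e → x ≢ y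
    properʳ : ∀ {x y e} → e ≺ (x , y) → x ≢ y
    meet    : ∀ {x y z w} → (x , y) ≺ (z , w) → (x ≡ z ⊎ x ≡ w) ⊎ (y ≡ z ⊎ y ≡ w)

opposite : EdgeOrder n → EdgeOrder n
opposite O = record
  { _≺_ = flip _≺_ ; _≺?_ = flip _≺?_ ; irrefl = irrefl
  ; ferrers = λ p q → Sum.swap (ferrers p q)
  ; swapˡ = swapʳ ; swapʳ = swapˡ ; properˡ = properʳ ; properʳ = properˡ
  ; meet = λ p → meet′ (meet p)
  } where
  open EdgeOrder O
  meet′ : ∀ {x y z w : Fin _} → (x ≡ z ⊎ x ≡ w) ⊎ (y ≡ z ⊎ y ≡ w) → (z ≡ x ⊎ z ≡ y) ⊎ (w ≡ x ⊎ w ≡ y)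
  meet′ (inj₁ (inj₁ p)) = inj₁ (inj₁ (sym p))
  meet′ (inj₁ (inj₂ p)) = inj₂ (inj₁ (sym p))
  meet′ (inj₂ (inj₁ p)) = inj₁ (inj₂ (sym p))
  meet′ (inj₂ (inj₂ p)) = inj₂ (inj₂ (sym p))

deleteVertex : Fin (suc n) → EdgeOrder (suc n) → EdgeOrder n
deleteVertex a O = record
  { _≺_ = λ e f → ι e ≺ ι f ; _≺?_ = λ e f → ι e ≺? ι f
  ; irrefl = irrefl ; ferrers = ferrers ; swapˡ = swapˡ ; swapʳ = swapʳ
  ; properˡ = λ p → properˡ p ∘ cong (punchIn a)
  ; properʳ = λ p → properʳ p ∘ cong (punchIn a)
  ; meet = λ p → Sum.map (Sum.map inj inj) (Sum.map inj inj) (meet p)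
  } where
  open EdgeOrder O
  ι : Pair _ → Pair _
  ι = Product.map (punchIn a) (punchIn a)
  inj : ∀ {x y} → punchIn a x ≡ punchIn a y → x ≡ y
  inj = punchIn-injective a _ _

Comparable : EdgeOrder n → Fin n → Fin n → Fin n → Set
Comparable O x y z = (x , y) ≺ (x , z) ⊎ (x , z) ≺ (x , y)
  where open EdgeOrder O

-- Covers of the cherries and deletion of stars

record Cover (n m : ℕ) : Set₁ where
  field
    order  : Fin m → EdgeOrder n
    covers : ∀ {x y z} → x ≢ y → x ≢ z → y ≢ z → ∃ λ i → Comparable (order i) x y z

module _ (O : EdgeOrder n) where
  open EdgeOrder O

  Avoids : Fin n → Set
  Avoids a = ∃ λ x → ∃ λ y → ∃ λ z → x ≢ a × y ≢ a × z ≢ a × (x , y) ≺ (x , z)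

  avoids? : ∀ a → Dec (Avoids a)
  avoids? a = any? λ x → any? λ y → any? λ z →
    ¬? (x ≟ a) ×-dec ¬? (y ≟ a) ×-dec ¬? (z ≟ a) ×-dec (x , y) ≺? (x , z)

  -- The point a may be the centre or an end of each comparable cherry.
  IsStar : Set
  IsStar = ∃ λ a → ¬ Avoids a

  isStar? : Dec IsStar
  isStar? = any? (¬? ∘ avoids?)

-- A cherry on the points other than a avoids a, so order i does not cover it and one of the
-- remaining orders does.
deleteStar : ∀ (C : Cover (suc n) (suc m)) i → IsStar (Cover.order C i) → Cover n m
deleteStar {n} {m} C i (a , star) = record
  { order = λ j → deleteVertex a (order (punchIn i j))
  ; covers = λ {x} {y} {z} x≢y x≢z y≢z →
      let j , comparable = covers (x≢y ∘ inj) (x≢z ∘ inj) (y≢z ∘ inj)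
          i≢j = λ i≡j → notStar x y z (subst (λ j → Comparable′ j x y z) (sym i≡j) comparable)
      in punchOut i≢j , subst (λ j → Comparable′ j x y z) (sym (punchIn-punchOut i≢j)) comparable
  } where
  open Cover C

  inj : ∀ {x y} → punchIn a x ≡ punchIn a y → x ≡ y
  inj = punchIn-injective a _ _

  Comparable′ : Fin (suc m) → Fin n → Fin n → Fin n → Set
  Comparable′ j x y z = Comparable (order j) (punchIn a x) (punchIn a y) (punchIn a z)

  notStar : ∀ x y z → ¬ Comparable′ i x y z
  notStar x y z (inj₁ p) = star (_ , _ , _ , punchInᵢ≢i a x , punchInᵢ≢i a y , punchInᵢ≢i a z , p)
  notStar x y z (inj₂ p) = star (_ , _ , _ , punchInᵢ≢i a x , punchInᵢ≢i a z , punchInᵢ≢i a y , p)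

-- Extreme pairs of an edge order

module _ {A : Set} {_⊑_ : Rel A 0ℓ} (⊑-refl : Reflexive _⊑_) (⊑-trans : Transitive _⊑_) (⊑-total : Total _⊑_) where

  maximum : ∀ {k} (f : Fin (suc k) → A) → ∃ λ i → ∀ j → f j ⊑ f i
  maximum {zero}  f = zero , λ { zero → ⊑-refl }
  maximum {suc k} f with maximum (f ∘ suc)
  ... | i , max with ⊑-total (f zero) (f (suc i))
  ...   | inj₁ f0⊑fi = suc i , λ { zero → f0⊑fi ; (suc j) → max j }
  ...   | inj₂ fi⊑f0 = zero , λ { zero → ⊑-refl ; (suc j) → ⊑-trans (max j) fi⊑f0 }

module _ (O : EdgeOrder (suc n)) where
  open EdgeOrder O

  private
    _⊑_ : Rel (Pair (suc n)) 0ℓ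
    e ⊑ f = ∀ {g} → e ≺ g → f ≺ g

    ⊑-total : Total _⊑_
    ⊑-total e f with any? (λ x → any? λ y → e ≺? (x , y) ×-dec ¬? (f ≺? (x , y)))
    ... | yes (_ , _ , e≺g , f⊀g) = inj₂ λ f≺h → [ id , (λ f≺g → contradiction f≺g f⊀g) ] (ferrers e≺g f≺h)
    ... | no ∄ = inj₁ λ {g} e≺g → forward g e≺g
      where
      forward : ∀ g → e ≺ g → f ≺ g
      forward g e≺g with f ≺? g
      ... | yes f≺g = f≺g
      ... | no  f⊀g = contradiction (_ , _ , e≺g , f⊀g) ∄

  -- By `ferrers` the sets of successors form a chain, and a pair with the largest set has the
  -- earliest right end. It is found by maximising over the second point and then over the first.
  earliest : ∃ λ p → ∀ {e f} → e ≺ f → p ≺ f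
  earliest =
    let best = λ x → maximum {_⊑_ = _⊑_} id (λ p q {_} → q ∘ p) ⊑-total (x ,_)
        x , x-max = maximum {_⊑_ = _⊑_} id (λ p q {_} → q ∘ p) ⊑-total (λ x → x , proj₁ (best x))
    in (x , proj₁ (best x)) , λ { {y , z} e≺f → x-max y (proj₂ (best y) z e≺f) }

allBut : List (Fin n) → List (Fin n)
allBut {n} []  = allFin n
allBut (x ∷ xs) = filter (λ y → ¬? (y ≟ x)) (allBut xs)

∈-allBut : ∀ {y : Fin n} {xs} → All (y ≢_) xs → y ∈ˡ allBut xs
∈-allBut []           = ∈-allFin _
∈-allBut (y≢x ∷ y≢xs) = ∈-filter⁺ (λ y → ¬? (y ≟ _)) (∈-allBut y≢xs) y≢x

length-allBut : ∀ {xs : List (Fin n)} → Unique xs → length xs + length (allBut xs) ≤ n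
length-allBut {n} []      = ≤-reflexive (length-tabulate {n = n} id)
length-allBut {xs = x ∷ xs} (x≢xs ∷ unique) = begin
  suc (length xs + length (allBut (x ∷ xs))) ≡⟨ sym (+-suc (length xs) _) ⟩
  length xs + suc (length (allBut (x ∷ xs))) ≤⟨ +-monoʳ-≤ (length xs)
    (filter-notAll (λ y → ¬? (y ≟ x)) (allBut xs) (lose (∈-allBut x≢xs) (λ x≢x → x≢x refl))) ⟩
  length xs + length (allBut xs)             ≤⟨ length-allBut unique ⟩
  _ ∎
  where open ≤-Reasoning

-- Frames of orders that are not stars

Triple : ℕ → Set
Triple n = Fin n × Fin n × Fin n

-- a, b and c span the first pair ab and the last pair ac, while b, c and z span
-- comparable pairs that avoid a.
record Frame (O : EdgeOrder n) : Set where
  open EdgeOrder O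
  field
    a b c z : Fin n
    a≢b : a ≢ b
    a≢c : a ≢ c
    b≢c : b ≢ c
    z≢a : z ≢ a
    z≢b : z ≢ b
    z≢c : z ≢ c
    first   : ∀ {e f} → e ≺ f → (a , b) ≺ f
    last    : ∀ {e f} → e ≺ f → e ≺ (a , c)

  OnTriangle : Fin n → Set
  OnTriangle x = x ≡ b ⊎ x ≡ c ⊎ x ≡ z

  field
    blocked : ∀ {x y} → (a , x) ≺ (a , y) → OnTriangle x ⊎ OnTriangle y

module _ (O : EdgeOrder n) where
  open EdgeOrder O

  -- Let xy ≺ xw avoid a. Then ab ≺ xw puts b in {x, w}, and xy ≺ ac puts c in {x, y}. As b and c
  -- differ, they are two of x, y, w, and the third one is z.
  path⇒frame : ∀ a b c →
    (∀ {e f} → e ≺ f → (a , b) ≺ f) → (∀ {e f} → e ≺ f → e ≺ (a , c)) → Avoids O a → Frame O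
  path⇒frame a b c first last (x , y , w , x≢a , y≢a , w≢a , xy≺xw) =
    build (avoidˡ (meet (first xy≺xw))) (avoidʳ (meet (last xy≺xw)))
    where
    ab≺ac : (a , b) ≺ (a , c)
    ab≺ac = last (first xy≺xw)

    avoidˡ : (a ≡ x ⊎ a ≡ w) ⊎ (b ≡ x ⊎ b ≡ w) → b ≡ x ⊎ b ≡ w
    avoidˡ (inj₁ (inj₁ a≡x)) = contradiction (sym a≡x) x≢a
    avoidˡ (inj₁ (inj₂ a≡w)) = contradiction (sym a≡w) w≢a
    avoidˡ (inj₂ p)          = p

    avoidʳ : (x ≡ a ⊎ x ≡ c) ⊎ (y ≡ a ⊎ y ≡ c) → x ≡ c ⊎ y ≡ c
    avoidʳ (inj₁ (inj₁ x≡a)) = contradiction x≡a x≢a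
    avoidʳ (inj₁ (inj₂ x≡c)) = inj₁ x≡c
    avoidʳ (inj₂ (inj₁ y≡a)) = contradiction y≡a y≢a
    avoidʳ (inj₂ (inj₂ y≡c)) = inj₂ y≡c

    -- The Ferrers property for as ≺ at and xy ≺ xw gives as ≺ xw, whence s is x or w, or xy ≺ at,
    -- whence t is x or y. The predicate `T` will be membership in {b, c, z}.
    blocked : ∀ {T : Fin n → Set} → T x → T y → T w → ∀ {s t} → (a , s) ≺ (a , t) → T s ⊎ T t
    blocked {T} Tx Ty Tw {s} {t} as≺at with ferrers as≺at xy≺xw
    ... | inj₁ as≺xw with meet as≺xw
    ...   | inj₁ (inj₁ a≡x) = contradiction (sym a≡x) x≢a
    ...   | inj₁ (inj₂ a≡w) = contradiction (sym a≡w) w≢a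
    ...   | inj₂ (inj₁ s≡x) = inj₁ (subst T (sym s≡x) Tx)
    ...   | inj₂ (inj₂ s≡w) = inj₁ (subst T (sym s≡w) Tw)
    blocked {T} Tx Ty Tw as≺at | inj₂ xy≺at with meet xy≺at
    ...   | inj₁ (inj₁ x≡a) = contradiction x≡a x≢a
    ...   | inj₁ (inj₂ x≡t) = inj₂ (subst T x≡t Tx)
    ...   | inj₂ (inj₁ y≡a) = contradiction y≡a y≢a
    ...   | inj₂ (inj₂ y≡t) = inj₂ (subst T y≡t Ty)

    y≢w : y ≢ w
    y≢w refl = irrefl xy≺xw

    frameAt : ∀ z → z ≢ a → z ≢ b → z ≢ c →
      let T = λ v → v ≡ b ⊎ v ≡ c ⊎ v ≡ z in T x → T y → T w → Frame O
    frameAt z z≢a z≢b z≢c Tx Ty Tw = record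
      { a = a ; b = b ; c = c ; z = z
      ; a≢b = properˡ ab≺ac ; a≢c = properʳ ab≺ac ; b≢c = λ { refl → irrefl ab≺ac }
      ; z≢a = z≢a ; z≢b = z≢b ; z≢c = z≢c
      ; first = first ; last = last
      ; blocked = blocked Tx Ty Tw
      }

    build : b ≡ x ⊎ b ≡ w → x ≡ c ⊎ y ≡ c → Frame O
    build (inj₁ refl) (inj₁ refl) = contradiction ab≺ac irrefl
    build (inj₁ refl) (inj₂ refl) = frameAt w w≢a (≢-sym (properʳ xy≺xw)) (≢-sym y≢w)
      (inj₁ refl) (inj₂ (inj₁ refl)) (inj₂ (inj₂ refl))
    build (inj₂ refl) (inj₁ refl) = frameAt y y≢a y≢w (≢-sym (properˡ xy≺xw))
      (inj₂ (inj₁ refl)) (inj₂ (inj₂ refl)) (inj₁ refl)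
    build (inj₂ refl) (inj₂ refl) = frameAt x x≢a (properʳ xy≺xw) (properˡ xy≺xw)
      (inj₂ (inj₂ refl)) (inj₂ (inj₁ refl)) (inj₁ refl)

-- Some comparison exists, so the earliest pair precedes the latest one and the two share a point.
-- That point becomes a, in four cases according to its positions.
nonStar⇒frame : ∀ (O : EdgeOrder (suc n)) → (∀ a → Avoids O a) → Frame O
nonStar⇒frame O avoids with earliest O | earliest (opposite O) | avoids zero
... | (p₁ , p₂) , first | (q₁ , q₂) , last | _ , _ , _ , _ , _ , _ , e≺f =
  choose (meet (last (first e≺f)))
  where
  open EdgeOrder O
  choose : (p₁ ≡ q₁ ⊎ p₁ ≡ q₂) ⊎ (p₂ ≡ q₁ ⊎ p₂ ≡ q₂) → Frame O
  choose (inj₁ (inj₁ refl)) = path⇒frame O p₁ p₂ q₂ first last (avoids p₁)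
  choose (inj₁ (inj₂ refl)) = path⇒frame O p₁ p₂ q₁ first (λ p → swapʳ (last p)) (avoids p₁)
  choose (inj₂ (inj₁ refl)) = path⇒frame O p₂ p₁ q₂ (λ p → swapˡ (first p)) last (avoids p₂)
  choose (inj₂ (inj₂ refl)) = path⇒frame O p₂ p₁ q₁ (λ p → swapˡ (first p)) (λ p → swapʳ (last p)) (avoids p₂)

-- At most 7n - 16 cherries in a framed order

witnesses : ∀ {A : Set} {P : A → Set} → Dec (∃ P) → List A
witnesses (yes (x , _)) = x ∷ []
witnesses (no  _)       = []

length-witnesses : ∀ {A : Set} {P : A → Set} (P? : Dec (∃ P)) → length (witnesses P?) ≤ 1
length-witnesses (yes _) = ≤-refl
length-witnesses (no  _) = z≤n

∈-witnesses : ∀ {A : Set} {P : A → Set} (P? : Dec (∃ P)) → (∀ {x y} → P x → P y → x ≡ y) →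
              ∀ {x} → P x → x ∈ˡ witnesses P?
∈-witnesses (yes (_ , py)) unique px = here (unique px py)
∈-witnesses (no  ∄)        _      px = contradiction (_ , px) ∄

module _ {O : EdgeOrder n} (F : Frame O) where
  open EdgeOrder O
  open Frame F

  Between : Fin n → Fin n → Fin n → Set
  Between s t x = (x , s) ≺ (x , t)

  between? : ∀ s t → Dec (∃ (Between s t))
  between? s t = any? λ x → (x , s) ≺? (x , t)

  -- Otherwise xs ≺ xt and ys ≺ yt would form a 2+2, as xs and yt are disjoint.
  between-unique : ∀ s t {x y} → Between s t x → Between s t y → x ≡ y
  between-unique s t {x} {y} p q = [ (λ r → disjoint p q (meet r)) , (λ r → sym (disjoint q p (meet r))) ] (ferrers p q)
    where
    disjoint : ∀ {x y} → Between s t x → Between s t y → (x ≡ y ⊎ x ≡ t) ⊎ (s ≡ y ⊎ s ≡ t) → x ≡ y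
    disjoint p q (inj₁ (inj₁ x≡y)) = x≡y
    disjoint p q (inj₁ (inj₂ x≡t)) = contradiction x≡t (properʳ p)
    disjoint p q (inj₂ (inj₁ s≡y)) = contradiction (sym s≡y) (properˡ q)
    disjoint p q (inj₂ (inj₂ refl)) = contradiction p irrefl

  -- If xy ≺ xw, then xw meets ab and xy meets ac; the groups are the resulting cases. Seven have
  -- one free end, and in the last three the ends are fixed and `between-unique` leaves at most one
  -- centre.
  cherryGroups : List (List (Triple n))
  cherryGroups =
    List.map (λ x → a , b , x) (allBut (a ∷ b ∷ [])) ∷
    List.map (λ x → a , x , c) (allBut (a ∷ b ∷ c ∷ [])) ∷
    List.map (λ x → b , a , x) (allBut (a ∷ b ∷ [])) ∷
    List.map (λ x → c , x , a) (allBut (a ∷ c ∷ [])) ∷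
    List.map (λ x → b , c , x) (allBut (a ∷ b ∷ c ∷ [])) ∷
    List.map (λ x → c , x , b) (allBut (a ∷ b ∷ c ∷ [])) ∷
    List.map (λ x → a , z , x) (allBut (a ∷ b ∷ c ∷ z ∷ [])) ∷
    List.map (λ x → x , a , b) (witnesses (between? a b)) ∷
    List.map (λ x → x , c , a) (witnesses (between? c a)) ∷
    List.map (λ x → x , c , b) (witnesses (between? c b)) ∷ []

  -- (x , y , w) lists the two pairs xy and xw that are comparable.
  cherries : List (Triple n)
  cherries = concat cherryGroups

  length-cherries : length cherries + 16 ≤ 7 * n
  -- The seven groups with a free end exclude 2 + 3 + 2 + 2 + 3 + 3 + 4 = 19 points in all, and the
  -- other three contribute at most 3 cherries, hence 16 = 19 - 3.
  length-cherries = +-cancelʳ-≤ 3 _ _ (begin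
    length cherries + 16 + 3
      ≡⟨ cong (λ l → l + 16 + 3) (length-group (allBut (a ∷ b ∷ [])) (length-group (allBut (a ∷ b ∷ c ∷ []))
        (length-group (allBut (a ∷ b ∷ [])) (length-group (allBut (a ∷ c ∷ []))
        (length-group (allBut (a ∷ b ∷ c ∷ [])) (length-group (allBut (a ∷ b ∷ c ∷ []))
        (length-group (allBut (a ∷ b ∷ c ∷ z ∷ [])) (length-group (witnesses (between? a b))
        (length-group (witnesses (between? c a)) (length-group (witnesses (between? c b)) refl)))))))))) ⟩
    _ ≡⟨ regroup (length (allBut (a ∷ b ∷ []))) (length (allBut (a ∷ b ∷ c ∷ []))) (length (allBut (a ∷ c ∷ [])))
        (length (allBut (a ∷ b ∷ c ∷ z ∷ []))) (length (witnesses (between? a b)))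
        (length (witnesses (between? c a))) (length (witnesses (between? c b))) ⟩
    _ ≤⟨ +-mono-≤ ab (+-mono-≤ abc (+-mono-≤ ab (+-mono-≤ ac (+-mono-≤ abc (+-mono-≤ abc (+-mono-≤ abcz
        (+-mono-≤ (length-witnesses (between? a b)) (+-mono-≤ (length-witnesses (between? c a)) (length-witnesses (between? c b)))))))))) ⟩
    _ ≡⟨ total n ⟩
    7 * n + 3 ∎)
    where
    open ≤-Reasoning
    length-group : ∀ {A : Set} {f : A → Triple n} {ts k} xs → length ts ≡ k →
                   length (List.map f xs ++ ts) ≡ length xs + k
    length-group {f = f} {ts} xs refl =
      trans (length-++ (List.map f xs)) (cong (_+ length ts) (length-map f xs))

    ab : 2 + length (allBut (a ∷ b ∷ [])) ≤ n
    ab = length-allBut ((a≢b ∷ []) ∷ [] ∷ [])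
    ac : 2 + length (allBut (a ∷ c ∷ [])) ≤ n
    ac = length-allBut ((a≢c ∷ []) ∷ [] ∷ [])
    abc : 3 + length (allBut (a ∷ b ∷ c ∷ [])) ≤ n
    abc = length-allBut ((a≢b ∷ a≢c ∷ []) ∷ (b≢c ∷ []) ∷ [] ∷ [])
    abcz : 4 + length (allBut (a ∷ b ∷ c ∷ z ∷ [])) ≤ n
    abcz = length-allBut
      ((a≢b ∷ a≢c ∷ ≢-sym z≢a ∷ []) ∷ (b≢c ∷ ≢-sym z≢b ∷ []) ∷ (≢-sym z≢c ∷ []) ∷ [] ∷ [])

    regroup : ∀ ab abc ac abcz u v w →
      (ab + (abc + (ab + (ac + (abc + (abc + (abcz + (u + (v + (w + 0)))))))))) + 16 + 3 ≡
      (2 + ab) + ((3 + abc) + ((2 + ab) + ((2 + ac) + ((3 + abc) + ((3 + abc) + ((4 + abcz) + (u + (v + w))))))))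
    regroup = solve-∀

    total : ∀ n → n + (n + (n + (n + (n + (n + (n + (1 + (1 + 1)))))))) ≡ 7 * n + 3
    total = solve-∀

  ∈-cherries : ∀ {x y w} → (x , y) ≺ (x , w) → (x , y , w) ∈ˡ cherries ⊎ (x , w , y) ∈ˡ cherries
  ∈-cherries {x} {y} {w} xy≺xw = classify (meet (last xy≺xw)) (meet (first xy≺xw))
    where
    group : ∀ k {t} → t ∈ˡ lookup cherryGroups k → t ∈ˡ cherries
    group k t∈ = ∈-concat⁺′ t∈ (∈-lookup {xs = cherryGroups} k)

    x≢y = properˡ xy≺xw
    x≢w = properʳ xy≺xw
    y≢w : y ≢ w
    y≢w refl = irrefl xy≺xw

    ¬≺ab : ∀ {e} → ¬ (e ≺ (a , b))
    ¬≺ab e≺ab = irrefl (first e≺ab)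
    ¬ac≺ : ∀ {f} → ¬ ((a , c) ≺ f)
    ¬ac≺ ac≺f = irrefl (last ac≺f)

    centre-a : x ≡ a → (x , y , w) ∈ˡ cherries ⊎ (x , w , y) ∈ˡ cherries
    centre-a refl with y ≟ b | w ≟ c
    ... | yes refl | _        = inj₁ (group 0F (∈-map⁺ _ (∈-allBut (≢-sym x≢w ∷ ≢-sym y≢w ∷ []))))
    ... | no  y≢b  | yes refl = inj₁ (group 1F (∈-map⁺ _ (∈-allBut (≢-sym x≢y ∷ y≢b ∷ y≢w ∷ []))))
    -- Nothing precedes ab and nothing follows ac, so neither y = c nor w = b is possible. Hence
    -- `blocked` leaves z as one of the ends; it may be either, which is why the conclusion allows
    -- both listings.
    ... | no  y≢b  | no  w≢c with blocked xy≺xw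
    ...   | inj₁ (inj₁ y≡b)         = contradiction y≡b y≢b
    ...   | inj₁ (inj₂ (inj₁ refl)) = contradiction xy≺xw ¬ac≺
    ...   | inj₂ (inj₁ refl)        = contradiction xy≺xw ¬≺ab
    ...   | inj₂ (inj₂ (inj₁ w≡c))  = contradiction w≡c w≢c
    ...   | inj₁ (inj₂ (inj₂ refl)) = inj₁ (group 6F (∈-map⁺ _
            (∈-allBut (≢-sym x≢w ∷ (λ { refl → ¬≺ab xy≺xw }) ∷ w≢c ∷ ≢-sym y≢w ∷ []))))
    ...   | inj₂ (inj₂ (inj₂ refl)) = inj₂ (group 6F (∈-map⁺ _
            (∈-allBut (≢-sym x≢y ∷ y≢b ∷ (λ { refl → ¬ac≺ xy≺xw }) ∷ y≢w ∷ []))))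

    classify : (x ≡ a ⊎ x ≡ c) ⊎ (y ≡ a ⊎ y ≡ c) → (a ≡ x ⊎ a ≡ w) ⊎ (b ≡ x ⊎ b ≡ w) →
               (x , y , w) ∈ˡ cherries ⊎ (x , w , y) ∈ˡ cherries
    classify (inj₁ (inj₁ x≡a)) _ = centre-a x≡a
    classify _ (inj₁ (inj₁ a≡x)) = centre-a (sym a≡x)
    classify (inj₁ (inj₂ refl)) (inj₁ (inj₂ refl)) =
      inj₁ (group 3F (∈-map⁺ _ (∈-allBut (y≢w ∷ ≢-sym x≢y ∷ []))))
    classify (inj₁ (inj₂ refl)) (inj₂ (inj₁ b≡c)) = contradiction b≡c b≢c
    classify (inj₁ (inj₂ refl)) (inj₂ (inj₂ refl)) =
      inj₁ (group 5F (∈-map⁺ _ (∈-allBut ((λ { refl → ¬ac≺ (swapˡ xy≺xw) }) ∷ y≢w ∷ ≢-sym x≢y ∷ []))))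
    classify (inj₂ (inj₁ refl)) (inj₁ (inj₂ refl)) = contradiction refl y≢w
    classify (inj₂ (inj₁ refl)) (inj₂ (inj₁ refl)) =
      inj₁ (group 2F (∈-map⁺ _ (∈-allBut (≢-sym y≢w ∷ ≢-sym x≢w ∷ []))))
    classify (inj₂ (inj₁ refl)) (inj₂ (inj₂ refl)) =
      inj₁ (group 7F (∈-map⁺ _ (∈-witnesses (between? a b) (between-unique a b) xy≺xw)))
    classify (inj₂ (inj₂ refl)) (inj₁ (inj₂ refl)) =
      inj₁ (group 8F (∈-map⁺ _ (∈-witnesses (between? c a) (between-unique c a) xy≺xw)))
    classify (inj₂ (inj₂ refl)) (inj₂ (inj₁ refl)) =
      inj₁ (group 4F (∈-map⁺ _ (∈-allBut ((λ { refl → ¬≺ab (swapʳ xy≺xw) }) ∷ ≢-sym x≢w ∷ ≢-sym y≢w ∷ []))))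
    classify (inj₂ (inj₂ refl)) (inj₂ (inj₂ refl)) =
      inj₁ (group 9F (∈-map⁺ _ (∈-witnesses (between? c b) (between-unique c b) xy≺xw)))

-- Counting the cherries of a cover

swapTriple : Triple n → Triple n
swapTriple (x , y , w) = x , w , y

distinctTriple : Fin (suc (suc n)) × Fin (suc n) × Fin n → Triple (suc (suc n))
distinctTriple (x , y , z) = x , punchIn x y , punchIn x (punchIn y z)

distinctTriple-injective : Injective _≡_ _≡_ (distinctTriple {n})
distinctTriple-injective {x = x , y , z} {x′ , y′ , z′} eq with cong proj₁ eq
... | refl with punchIn-injective x y y′ (cong (proj₁ ∘ proj₂) eq)
...   | refl with punchIn-injective y z z′ (punchIn-injective x _ _ (cong (proj₂ ∘ proj₂) eq))
...     | refl = refl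

remQuot³ : ∀ {l m n} → Fin (l * (m * n)) → Fin l × Fin m × Fin n
remQuot³ {m = m} {n} = Product.map₂ (remQuot n) ∘ remQuot (m * n)

remQuot-injective : ∀ {m} n → Injective _≡_ _≡_ (remQuot {m} n)
remQuot-injective {m} n {i} {j} eq = trans (sym (combine-remQuot {m} n i))
  (trans (cong (λ (x , y) → combine x y) eq) (combine-remQuot {m} n j))

remQuot³-injective : ∀ {l m n} → Injective _≡_ _≡_ (remQuot³ {l} {m} {n})
remQuot³-injective {m = m} {n} eq = remQuot-injective (m * n)
  (cong₂ _,_ (cong proj₁ eq) (remQuot-injective n (cong proj₂ eq)))

injective⇒≤length : ∀ {A : Set} {k} {f : Fin k → A} → Injective _≡_ _≡_ f →
                    ∀ {xs} → (∀ i → f i ∈ˡ xs) → k ≤ length xs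
injective⇒≤length {f = f} f-inj {xs} f∈xs = injective⇒≤ {f = index ∘ f∈xs} λ {i} {j} eq →
  f-inj (trans (lookup-index (f∈xs i)) (trans (cong (lookup xs) eq) (sym (lookup-index (f∈xs j)))))

length-concatMap-≤ : ∀ {A B : Set} {k} (f : A → List B) xs → (∀ x → length (f x) ≤ k) →
                     length (concatMap f xs) ≤ length xs * k
length-concatMap-≤ f []       _  = z≤n
length-concatMap-≤ f (x ∷ xs) ≤k = ≤-trans (≤-reflexive (length-++ (f x)))
  (+-mono-≤ (≤k x) (length-concatMap-≤ f xs ≤k))

-- Cherries are counted as ordered triples of distinct points, each of them twice. The factor 2 on
-- the right accounts for the two listings of a cherry.
triples-bound : ∀ {n m} (C : Cover (2 + n) m) → (∀ i → Frame (Cover.order C i)) →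
                (2 + n) * ((1 + n) * n) ≤ m * (2 * (7 * (2 + n) ∸ 16))
triples-bound {n} {m} C frame = begin
  (2 + n) * ((1 + n) * n) ≤⟨ injective⇒≤length
      {f = distinctTriple ∘ remQuot³} (remQuot³-injective {suc (suc n)} {suc n} {n} ∘ distinctTriple-injective) (λ i → listed (remQuot³ i)) ⟩
  length (concatMap covered (allFin m)) ≤⟨ length-concatMap-≤ covered (allFin m) length-covered ⟩
  length (allFin m) * (2 * K)   ≡⟨ cong (_* (2 * K)) (length-tabulate {n = m} id) ⟩
  m * (2 * K)                   ∎
  where
  open ≤-Reasoning
  open Cover C
  K = 7 * (2 + n) ∸ 16

  covered : Fin m → List (Triple (2 + n))
  covered i = cherries (frame i) ++ List.map swapTriple (cherries (frame i))

  length-covered : ∀ i → length (covered i) ≤ 2 * K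
  length-covered i = begin
    length (covered i)
      ≡⟨ length-++ L ⟩
    length L + length (List.map swapTriple L)
      ≡⟨ cong (length L +_) (trans (length-map swapTriple L) (sym (+-identityʳ _))) ⟩
    2 * length L
      ≤⟨ *-monoʳ-≤ 2 (m+n≤o⇒m≤o∸n (length L) (length-cherries (frame i))) ⟩
    2 * K ∎
    where L = cherries (frame i)

  listed : ∀ t → distinctTriple t ∈ˡ concatMap covered (allFin m)
  listed (x , y , z) with covers (≢-sym (punchInᵢ≢i x y)) (≢-sym (punchInᵢ≢i x (punchIn y z)))
                            (≢-sym (punchInᵢ≢i y z) ∘ punchIn-injective x _ _)
  ... | i , comparable = ∈-concat⁺′ (in-covered comparable) (∈-map⁺ covered (∈-allFin i))
    where
    in-covered : ∀ {x y z} → Comparable (order i) x y z → (x , y , z) ∈ˡ covered i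
    in-covered (inj₁ p) = [ ∈-++⁺ˡ , (λ t∈ → ∈-++⁺ʳ _ (∈-map⁺ swapTriple t∈)) ] (∈-cherries (frame i) p)
    in-covered (inj₂ p) = [ (λ t∈ → ∈-++⁺ʳ _ (∈-map⁺ swapTriple t∈)) , ∈-++⁺ˡ ] (∈-cherries (frame i) p)

-- The difference of the two sides is j³ − 2j² − 5j + 22, a polynomial with positive
-- coefficients in i = j − 4.
too-few : ∀ j → (1 + j) * (2 * (7 * (5 + j) ∸ 16)) < (5 + j) * ((4 + j) * (3 + j))
too-few 0 = <ᵇ⇒< _ _ _
too-few 1 = <ᵇ⇒< _ _ _
too-few 2 = <ᵇ⇒< _ _ _
too-few 3 = <ᵇ⇒< _ _ _
too-few (suc (suc (suc (suc i)))) = begin-strict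
  (5 + i) * (2 * (7 * (9 + i) ∸ 16))
    ≡⟨ cong (λ k → (5 + i) * (2 * (k ∸ 16))) (split i) ⟩
  (5 + i) * (2 * ((47 + 7 * i) + 16 ∸ 16))
    ≡⟨ cong (λ k → (5 + i) * (2 * k)) (m+n∸n≡m (47 + 7 * i) 16) ⟩
  (5 + i) * (2 * (47 + 7 * i))
    <⟨ m<m+n _ {34 + (27 * i + 10 * (i * i) + i * (i * i))} (s≤s z≤n) ⟩
  (5 + i) * (2 * (47 + 7 * i)) + (34 + (27 * i + 10 * (i * i) + i * (i * i)))
    ≡⟨ expand i ⟩
  (9 + i) * ((8 + i) * (7 + i)) ∎
  where
  open ≤-Reasoning
  split : ∀ i → 7 * (9 + i) ≡ (47 + 7 * i) + 16
  split = solve-∀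
  expand : ∀ i → (5 + i) * (2 * (47 + 7 * i)) + (34 + (27 * i + 10 * (i * i) + i * (i * i))) ≡
                 (9 + i) * ((8 + i) * (7 + i))
  expand = solve-∀

-- There are n = 5 + j points and at most 1 + j = n - 4 orders, so the count contradicts `too-few`.
someStar : ∀ {m j} → m ≤ j → (C : Cover (5 + j) (1 + m)) → ¬ (∀ i → Frame (Cover.order C i))
someStar {m} {j} m≤j C frame = <⇒≱ (too-few j) (≤-trans (triples-bound C frame) (*-monoˡ-≤ _ (s≤s m≤j)))

-- Induction on the number of orders: deleting a star lowers m and n by one each, and without stars
-- every order has a frame, so the count applies.
cover⇒≤ : ∀ m n → Cover n m → n ≤ 3 + m
cover⇒≤ zero n C = ≮⇒≥ λ { (s≤s (s≤s (s≤s (s≤s _)))) →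
  case Cover.covers C {0F} {1F} {2F} (λ ()) (λ ()) (λ ()) of λ { (() , _) } }
cover⇒≤ (suc m) zero    C = z≤n
cover⇒≤ (suc m) (suc n) C with any? (λ i → isStar? (Cover.order C i))
... | yes (i , star) = s≤s (cover⇒≤ m n (deleteStar C i star))
... | no  noStar     = ≮⇒≥ λ { (s≤s (s≤s (s≤s (s≤s (s≤s m≤j))))) → someStar m≤j C λ i →
  nonStar⇒frame (Cover.order C i) λ a → decidable-stable (avoids? (Cover.order C i) a) λ star →
    noStar (i , a , star) }

-- From box representations to covers, and the boxicity

module _ (O : IntervalOrders (Kn 2 n) m) where
  open IntervalOrders O

  edgeOrder : Fin m → EdgeOrder n
  edgeOrder i = record
    { _≺_     = _≺_
    ; _≺?_    = λ (x , y) (z , w) → decide x y z w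
    ; irrefl  = λ { (p , q , e≺e) → ≺-irrefl i (edge q) (subst (_≺[ i ] edge q) (edge-cong p q refl refl) e≺e) }
    ; ferrers = λ { (p , q , e≺f) (p′ , q′ , e′≺f′) → Sum.map (λ r → p , q′ , r) (λ r → p′ , q , r)
        (≺-ferrers i (edge p) (edge q) (edge p′) (edge q′) e≺f e′≺f′) }
    ; swapˡ   = λ { (p , q , e≺f) → ≢-sym p , q , subst (_≺[ i ] edge q) (edge-comm p (≢-sym p)) e≺f }
    ; swapʳ   = λ { (p , q , e≺f) → p , ≢-sym q , subst (edge p ≺[ i ]_) (edge-comm q (≢-sym q)) e≺f }
    ; properˡ = λ (p , _) → p
    ; properʳ = λ (_ , q , _) → q
    ; meet    = λ (p , q , e≺f) → intersect p q (≁⇒common (edge p) (edge q) (sound i _ _ e≺f))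
    }
    where
    _≺_ : Pair n → Pair n → Set
    (x , y) ≺ (z , w) = ∃ λ (x≢y : x ≢ y) → ∃ λ (z≢w : z ≢ w) → edge x≢y ≺[ i ] edge z≢w

    decide : ∀ x y z w → Dec ((x , y) ≺ (z , w))
    decide x y z w with x ≟ y | z ≟ w
    ... | yes x≡y | _       = no λ (x≢y , _) → x≢y x≡y
    ... | no  _   | yes z≡w = no λ (_ , z≢w , _) → z≢w z≡w
    ... | no  x≢y | no  z≢w = map′ (λ e≺f → x≢y , z≢w , e≺f)
      (λ (p , q , e≺f) → subst (edge x≢y ≺[ i ]_) (edge-cong q z≢w refl refl)
                           (subst (_≺[ i ] edge q) (edge-cong p x≢y refl refl) e≺f))
      (T? (before i (edge x≢y) (edge z≢w)))

    intersect : ∀ {x y z w} (p : x ≢ y) (q : z ≢ w) → (∃ λ v → v ∈ᵛ edge p × v ∈ᵛ edge q) →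
                (x ≡ z ⊎ x ≡ w) ⊎ (y ≡ z ⊎ y ≡ w)
    intersect p q (v , v∈p , v∈q) with ∈-edge⁻ p v∈p
    ... | inj₁ refl = inj₁ (∈-edge⁻ q v∈q)
    ... | inj₂ refl = inj₂ (∈-edge⁻ q v∈q)

  orders⇒cover : Cover n m
  orders⇒cover = record
    { order  = edgeOrder
    ; covers = λ {x} x≢y x≢z y≢z →
        let i , comparable = complete (edge x≢y) (edge x≢z)
              (λ eq → [ ≢-sym x≢y , y≢z ] (∈-edge⁻ x≢z (subst (_ ∈ᵛ_) eq (∈-edgeʳ x≢y))))
              (common⇒≁ (edge x≢y) (edge x≢z) (∈-edgeˡ x≢y) (∈-edgeˡ x≢z))
        in i , Sum.map (λ r → x≢y , x≢z , r) (λ r → x≢z , x≢y , r) comparable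
    }

open module Kneser {n} = FiniteGraph (Kn 2 (suc n)) _≟ᵛ_ _~?_ (vertices n) allVertices

-- The inequality is decidable, so interval orders up to double negation are enough.
lower-bound : HasBoxRepresentation (Kn 2 (3 + n)) m → n ≤ m
lower-bound {n} {m} B = decidable-stable (n ≤? m) λ n≰m →
  boxes⇒¬¬orders B λ O → n≰m (+-cancelˡ-≤ 3 n m (cover⇒≤ m (3 + n) (orders⇒cover O)))

corollary1p4 : (n : ℕ) → n ≥ 5 → IsBoxicity (Kn 2 n) (n ∸ 3) ⊎ IsBoxicity (Kn 2 n) (n ∸ 2)
-- After the match `n` is three less than the number of points, so the search concerns the smaller
-- of the two candidates. If it fails, the lower bound becomes strict and meets the dimension of the
-- star representation.
corollary1p4 (suc (suc (suc n))) (s≤s (s≤s (s≤s _))) with boxes? n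
... | yes B  = inj₁ (B , λ m → lower-bound)
... | no  ¬B = inj₂ (endpoints⇒boxes (Stars.representation n) , λ m B →
  ≤∧≢⇒< (lower-bound B) λ { refl → ¬B B })
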